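{- Let $\boldsymbol{\gamma}_7$ be the following element of the non-oriented graph complex: the real linear combination $\boldsymbol{\gamma}_7=\sum_{k=1}^{46} c_k\,\Gamma_k$, where each $\Gamma_k$ is the simple graph on the vertex set $\{1,\dots,8\}$ with the $14$ edges listed below (an entry $ij$ denotes the edge $\{i,j\}$), the edges being ordered $I\wedge II\wedge\cdots\wedge XIV$ in the order listed (which is lexicographic), and $c_k$ is the coefficient given after the colon: 1. 16 17 18 23 25 28 34 38 46 48 57 58 68 78 : $1$; 2. 12 14 18 23 27 35 37 46 48 57 58 67 68 78 : $-21/8$; 3. 13 14 18 23 25 28 37 46 48 56 57 67 68 78 : $-77/4$; 4. 12 13 15 24 27 35 36 46 48 57 58 67 68 78 : $-35/8$; 5. 12 13 18 24 26 37 38 46 47 56 57 58 68 78 : $49/8$; 6. 14 17 18 23 25 26 35 37 46 48 56 58 67 78 : $77/8$; 7. 12 13 18 26 27 35 38 45 46 47 56 57 68 78 : $-105/8$; 8. 12 14 18 23 27 36 38 46 48 56 57 58 67 78 : $7/8$; 9. 12 14 15 23 27 35 36 46 48 57 58 67 68 78 : $35/8$; 10. 12 13 14 27 28 36 38 46 47 56 57 58 68 78 : $-49/8$; 11. 12 13 18 25 27 34 36 47 48 56 58 67 68 78 : $35/4$; 12. 12 13 14 25 26 36 38 45 47 57 58 67 68 78 : $-119/16$; 13. 12 13 15 24 28 36 38 47 48 56 57 67 68 78 : $49/8$; 14. 12 13 14 23 28 37 46 48 56 57 58 67 68 78 : $77/4$; 15. 12 15 17 25 26 35 36 38 45 47 48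 67 68 78 : $-49/8$; 16. 13 15 18 24 26 28 37 38 46 47 56 57 68 78 : $-49/4$; 17. 13 14 18 25 26 28 36 38 47 48 56 57 67 78 : $-49/4$; 18. 12 14 18 23 28 35 37 46 48 56 57 67 68 78 : $-7$; 19. 12 14 18 23 28 36 38 46 47 56 57 58 67 78 : $-7$; 20. 12 15 16 25 27 35 36 38 46 47 48 58 67 78 : $49/8$; 21. 12 14 18 23 28 36 37 46 47 56 57 58 68 78 : $49/8$; 22. 12 13 15 26 27 35 36 45 47 48 58 67 68 78 : $-7$; 23. 12 13 18 24 28 35 38 46 47 57 58 67 68 78 : $7$; 24. 12 13 18 25 26 37 38 45 46 47 56 57 68 78 : $-7$; 25. 12 14 16 23 25 36 37 45 48 57 58 67 68 78 : $77/8$; 26. 13 16 17 24 25 26 35 37 45 48 58 67 68 78 : $-7$; 27. 14 15 17 23 26 28 37 38 46 48 56 57 68 78 : $49/4$; 28. 12 16 18 27 28 34 36 38 46 47 56 57 58 78 : $-147/8$; 29. 12 15 16 27 28 35 36 38 45 46 47 57 68 78 : $-21/8$; 30. 12 14 18 23 27 35 36 45 46 57 58 67 68 78 : $-35/8$; 31. 14 15 16 23 26 28 37 38 46 48 57 58 67 78 : $-49/4$; 32. 12 15 18 23 28 34 37 46 48 56 57 67 68 78 : $105/8$; 33. 12 14 17 23 26 37 38 46 48 56 57 58 68 78 : $-49/8$; 34. 12 16 18 25 27 35 36 37 45 46 48 57 68 78 : $49/16$; 35. 12 13 18 25 27 35 36 46 47 48 56 57 68 78 : $7$; 36. 12 14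 18 25 28 34 36 38 47 57 58 67 68 78 : $-7$; 37. 12 16 18 25 27 35 36 37 45 46 48 58 67 78 : $-77/16$; 38. 12 14 18 23 27 35 38 46 47 57 58 67 68 78 : $77/4$; 39. 12 14 15 23 27 36 38 46 48 57 58 67 68 78 : $35/2$; 40. 12 13 18 25 27 34 36 46 48 57 58 67 68 78 : $-105/8$; 41. 12 15 16 25 27 35 36 38 46 47 48 57 68 78 : $-7$; 42. 12 13 16 25 28 34 37 47 48 57 58 67 68 78 : $-147/16$; 43. 12 13 17 25 26 35 37 45 46 48 58 67 68 78 : $-77/4$; 44. 12 14 17 23 27 35 38 46 48 57 58 67 68 78 : $-49/8$; 45. 12 13 15 26 28 35 37 45 46 47 58 67 68 78 : $-7/4$; 46. 12 14 18 23 26 36 38 47 48 56 57 58 67 78 : $-7$. (The first graph is the heptagon wheel: vertex $8$ joined to all of $1,\dots,7$, which form the cycle $1\!-\!6\!-\!4\!-\!3\!-\!2\!-\!5\!-\!7\!-\!1$.) Then $\mathrm{d}(\boldsymbol{\gamma}_7)=0$, and $\boldsymbol{\gamma}_7$ is a representative of the nontrivial cohomology class (the heptagon-wheel cocycle class) of the connected graph complex in bi-degree ($8$ vertices, $14$ edges), i.e. it is a $\mathrm{d}$-cocycle that is not a $\mathrm{d}$-coboundary.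
   Context: The non-oriented graph complex: the real vector space spanned by pairs $(\Gamma,\mathsf{E})$ where $\Gamma$ is a finite simple graph (no multiple edges, no loops) and $\mathsf{E}$ is an ordering of its edge set written as a wedge product $e_1\wedge\cdots\wedge e_m$, modulo the relations that for isomorphic graphs the element with edge ordering changed by a permutation $\sigma$ (transported along an isomorphism) equals $\mathrm{sign}(\sigma)$ times the original; in particular a graph with an automorphism inducing an odd permutation of its edges equals zero. For graphs $\gamma_1,\gamma_2$, the insertion $\gamma_1\circ\gamma_2$ is the sum, over all vertices $v$ of $\gamma_2$ and over all ways of re-attaching each edge formerly incident to $v$ to some vertex of $\gamma_1$, of the graph obtained by replacing $v$ by a copy of $\gamma_1$; each such term carries the edge ordering $\mathsf{E}(\gamma_1)\wedge\mathsf{E}(\gamma_2)$. The bracket is $[\gamma_1,\gamma_2]=\gamma_1\circ\gamma_2-(-1)^{\#\mathsf{E}(\gamma_1)\#\mathsf{E}(\gamma_2)}\gamma_2\circ\gamma_1$, extended bilinearly, and the differential is $\mathrm{d}(\gamma)=[\bullet\!-\!\bullet,\gamma]$, where $\bullet\!-\!\bullet$ is the graph with two vertices and one edge; $\mathrm{d}^2=0$. The connected graph complex is the subcomplex spanned by connected graphs; $\mathrm{d}$ preserves it and maps graphs with $n$ vertices and $e$ edges to graphs with $n+1$ vertices and $e+1$ edges. A coboundary is an element $\mathrm{d}(\delta)$ with $\delta$ in the connected graph complex.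
   Formalization: The graph complex is taken over the rational numbers instead of the real numbers, so the elements δ excluded as preimages of γ₇ under d have rational coefficients. -}

module Defs where

open import Data.Nat using (ℕ; zero; suc; _+_; _*_)
open import Data.Fin using (Fin; #_; _↑ˡ_; _↑ʳ_; punchOut)
open import Data.Fin.Properties using (_≟_)
open import Data.Fin.Permutation using (Permutation′; _⟨$⟩ʳ_)
open import Data.Integer using (+_)
open import Data.Rational using (ℚ; _/_; -_; 0ℚ; 1ℚ) renaming (_+_ to _+ℚ_; _*_ to _*ℚ_)
open import Data.List using (List; []; _∷_; [_]; _++_; map; concatMap; length; foldr)
open import Data.List.Membership.Propositional using (_∈_)
open import Data.List.Relation.Unary.All using (All)
open import Data.List.Relation.Unary.AllPairs using (AllPairs)
open import Data.Product using (Σ; _×_; _,_; proj₁; proj₂)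
open import Data.Sum using (_⊎_)
open import Relation.Binary.PropositionalEquality using (_≡_; _≢_)
open import Relation.Binary.Definitions using (DecidableEquality)
open import Relation.Nullary using (¬_; yes; no)
import Data.List.Properties as LP
import Data.Product.Properties as PP
open import Data.List.Base using () renaming (allFin to allFinL)

-- Labelled graphs with an ordered edge list.
-- A graph on vertex set Fin n; the edge list gives the edge ordering
-- e₁ ∧ ⋯ ∧ eₘ.  An edge is stored as a pair of endpoints; since the
-- complex is non-oriented, swapping the endpoints of an edge is
-- identified with the original (see the relation 'flipE' below).

Edge : ℕ → Set
Edge n = Fin n × Fin n

Edges : ℕ → Set
Edges n = List (Edge n)

LGraph : Set
LGraph = Σ ℕ Edges

vertices : LGraph → ℕ
vertices = proj₁

edgeCount : LGraph → ℕ
edgeCount (_ , es) = length es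

SameEdge : ∀ {n} → Edge n → Edge n → Set
SameEdge (a , b) (c , d) = (a ≡ c × b ≡ d) ⊎ (a ≡ d × b ≡ c)

Simple : LGraph → Set
Simple (n , es) = All (λ { (a , b) → a ≢ b }) es × AllPairs (λ e e′ → ¬ SameEdge e e′) es

data Reach {n : ℕ} (es : Edges n) : Fin n → Fin n → Set where
  here : ∀ {i} → Reach es i i
  step : ∀ {i j k} → ((i , j) ∈ es ⊎ (j , i) ∈ es) → Reach es j k → Reach es i k

Connected : LGraph → Set
Connected (n , es) = (i j : Fin n) → Reach es i j

Combo : Set
Combo = List (ℚ × LGraph)

_≟G_ : DecidableEquality LGraph
_≟G_ = PP.≡-dec Data.Nat._≟_ (LP.≡-dec (PP.≡-dec _≟_ _≟_))
  where import Data.Nat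

coeff : Combo → LGraph → ℚ
coeff [] H = 0ℚ
coeff ((q , G) ∷ x) H with G ≟G H
... | yes _ = q +ℚ coeff x H
... | no _ = coeff x H

scale : ℚ → Combo → Combo
scale c = map (λ { (q , G) → (c *ℚ q , G) })

_−_ : Combo → Combo → Combo
x − y = x ++ scale (- 1ℚ) y

negPow : ℕ → ℚ
negPow zero = 1ℚ
negPow (suc k) = - negPow k

-- The relations of the non-oriented graph complex.
-- They generate the subspace spanned by  (Γ,E) − sign(σ)·(Γ′,E′)
-- for (Γ′,E′) obtained from (Γ,E) by an isomorphism and a permutation σ
-- of the edge order: relabelling vertices (sign +1), transposing two
-- adjacent edges (sign −1; these generate all permutations), and
-- swapping the two endpoints of an edge (edges are unordered).

relabelEdges : ∀ {n} → Permutation′ n → Edges n → Edges n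
relabelEdges π = map (λ { (a , b) → (π ⟨$⟩ʳ a , π ⟨$⟩ʳ b) })

data Move : Set where
  relabel : (n : ℕ) → Edges n → Permutation′ n → Move
  swapE   : (n : ℕ) (xs : Edges n) (a b : Edge n) (ys : Edges n) → Move
  flipE   : (n : ℕ) (xs : Edges n) (a b : Fin n) (ys : Edges n) → Move

source : Move → LGraph
source (relabel n es π) = (n , es)
source (swapE n xs a b ys) = (n , xs ++ a ∷ b ∷ ys)
source (flipE n xs a b ys) = (n , xs ++ (a , b) ∷ ys)

-- the relation vector  source − sign · target
relation : Move → Combo
relation (relabel n es π) = (1ℚ , (n , es)) ∷ (- 1ℚ , (n , relabelEdges π es)) ∷ []
relation (swapE n xs a b ys) = (1ℚ , (n , xs ++ a ∷ b ∷ ys)) ∷ (1ℚ , (n , xs ++ b ∷ a ∷ ys)) ∷ []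
relation (flipE n xs a b ys) = (1ℚ , (n , xs ++ (a , b) ∷ ys)) ∷ (- 1ℚ , (n , xs ++ (b , a) ∷ ys)) ∷ []

IsZero : Combo → Set
IsZero x = Σ (List (ℚ × Σ Move (λ m → Simple (source m)))) λ rs →
  (H : LGraph) → coeff x H ≡ coeff (concatMap (λ { (q , (m , _)) → scale q (relation m) }) rs) H

-- Insertion γ₁ ∘ γ₂: replace a vertex v of γ₂ (with n₂ = suc m vertices)
-- by a copy of γ₁; the resulting graph has vertex set Fin (n₁ + m), the
-- first n₁ vertices being those of γ₁ and the remaining ones those of γ₂
-- other than v (relabelled by punchOut).  Each edge formerly incident to
-- v is re-attached to any vertex of γ₁ (all choices are summed over).
-- Edge ordering: E(γ₁) ∧ E(γ₂).

module _ (n₁ m : ℕ) (v : Fin (suc m)) where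

  endpoint : Fin (suc m) → List (Fin (n₁ + m))
  endpoint w with v ≟ w
  ... | yes _ = map (_↑ˡ m) (allFinL n₁)
  ... | no p = [ n₁ ↑ʳ punchOut p ]

  reattach : Edges (suc m) → List (Edges (n₁ + m))
  reattach [] = [ [] ]
  reattach ((a , b) ∷ es) =
    concatMap (λ a′ → concatMap (λ b′ → map ((a′ , b′) ∷_) (reattach es)) (endpoint b)) (endpoint a)

ins : LGraph → LGraph → List LGraph
ins (n₁ , es₁) (zero , es₂) = []
ins (n₁ , es₁) (suc m , es₂) =
  concatMap (λ v → map (λ es → (n₁ + m , map (λ { (a , b) → (a ↑ˡ m , b ↑ˡ m) }) es₁ ++ es))
                       (reattach n₁ m v es₂))
            (allFinL (suc m))

bracket : Combo → Combo → Combo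
bracket x y =
  concatMap (λ { (p , g) → concatMap (λ { (q , h) →
      map (λ r → (p *ℚ q , r)) (ins g h)
      ++ map (λ r → (- (negPow (edgeCount g * edgeCount h)) *ℚ (p *ℚ q) , r)) (ins h g) }) y }) x

dot-dot : LGraph
dot-dot = (2 , (# 0 , # 1) ∷ [])

d : Combo → Combo
d x = bracket ((1ℚ , dot-dot) ∷ []) x

-- The heptagon-wheel cocycle γ₇ (vertex i of the paper is # (i-1)).

γ₇ : Combo
γ₇ =
  ((+ 1 / 1) , (8 , (# 0 , # 5) ∷ (# 0 , # 6) ∷ (# 0 , # 7) ∷ (# 1 , # 2) ∷ (# 1 , # 4) ∷ (# 1 , # 7) ∷ (# 2 , # 3) ∷ (# 2 , # 7) ∷ (# 3 , # 5) ∷ (# 3 , # 7) ∷ (# 4 , # 6) ∷ (# 4 , # 7) ∷ (# 5 , # 7) ∷ (# 6 , # 7) ∷ []))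
  ∷
  ((- (+ 21 / 8)) , (8 , (# 0 , # 1) ∷ (# 0 , # 3) ∷ (# 0 , # 7) ∷ (# 1 , # 2) ∷ (# 1 , # 6) ∷ (# 2 , # 4) ∷ (# 2 , # 6) ∷ (# 3 , # 5) ∷ (# 3 , # 7) ∷ (# 4 , # 6) ∷ (# 4 , # 7) ∷ (# 5 , # 6) ∷ (# 5 , # 7) ∷ (# 6 , # 7) ∷ []))
  ∷
  ((- (+ 77 / 4)) , (8 , (# 0 , # 2) ∷ (# 0 , # 3) ∷ (# 0 , # 7) ∷ (# 1 , # 2) ∷ (# 1 , # 4) ∷ (# 1 , # 7) ∷ (# 2 , # 6) ∷ (# 3 , # 5) ∷ (# 3 , # 7) ∷ (# 4 , # 5) ∷ (# 4 , # 6) ∷ (# 5 , # 6) ∷ (# 5 , # 7) ∷ (# 6 , # 7) ∷ []))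
  ∷
  ((- (+ 35 / 8)) , (8 , (# 0 , # 1) ∷ (# 0 , # 2) ∷ (# 0 , # 4) ∷ (# 1 , # 3) ∷ (# 1 , # 6) ∷ (# 2 , # 4) ∷ (# 2 , # 5) ∷ (# 3 , # 5) ∷ (# 3 , # 7) ∷ (# 4 , # 6) ∷ (# 4 , # 7) ∷ (# 5 , # 6) ∷ (# 5 , # 7) ∷ (# 6 , # 7) ∷ []))
  ∷
  ((+ 49 / 8) , (8 , (# 0 , # 1) ∷ (# 0 , # 2) ∷ (# 0 , # 7) ∷ (# 1 , # 3) ∷ (# 1 , # 5) ∷ (# 2 , # 6) ∷ (# 2 , # 7) ∷ (# 3 , # 5) ∷ (# 3 , # 6) ∷ (# 4 , # 5) ∷ (# 4 , # 6) ∷ (# 4 , # 7) ∷ (# 5 , # 7) ∷ (# 6 , # 7) ∷ []))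
  ∷
  ((+ 77 / 8) , (8 , (# 0 , # 3) ∷ (# 0 , # 6) ∷ (# 0 , # 7) ∷ (# 1 , # 2) ∷ (# 1 , # 4) ∷ (# 1 , # 5) ∷ (# 2 , # 4) ∷ (# 2 , # 6) ∷ (# 3 , # 5) ∷ (# 3 , # 7) ∷ (# 4 , # 5) ∷ (# 4 , # 7) ∷ (# 5 , # 6) ∷ (# 6 , # 7) ∷ []))
  ∷
  ((- (+ 105 / 8)) , (8 , (# 0 , # 1) ∷ (# 0 , # 2) ∷ (# 0 , # 7) ∷ (# 1 , # 5) ∷ (# 1 , # 6) ∷ (# 2 , # 4) ∷ (# 2 , # 7) ∷ (# 3 , # 4) ∷ (# 3 , # 5) ∷ (# 3 , # 6) ∷ (# 4 , # 5) ∷ (# 4 , # 6) ∷ (# 5 , # 7) ∷ (# 6 , # 7) ∷ []))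
  ∷
  ((+ 7 / 8) , (8 , (# 0 , # 1) ∷ (# 0 , # 3) ∷ (# 0 , # 7) ∷ (# 1 , # 2) ∷ (# 1 , # 6) ∷ (# 2 , # 5) ∷ (# 2 , # 7) ∷ (# 3 , # 5) ∷ (# 3 , # 7) ∷ (# 4 , # 5) ∷ (# 4 , # 6) ∷ (# 4 , # 7) ∷ (# 5 , # 6) ∷ (# 6 , # 7) ∷ []))
  ∷
  ((+ 35 / 8) , (8 , (# 0 , # 1) ∷ (# 0 , # 3) ∷ (# 0 , # 4) ∷ (# 1 , # 2) ∷ (# 1 , # 6) ∷ (# 2 , # 4) ∷ (# 2 , # 5) ∷ (# 3 , # 5) ∷ (# 3 , # 7) ∷ (# 4 , # 6) ∷ (# 4 , # 7) ∷ (# 5 , # 6) ∷ (# 5 , # 7) ∷ (# 6 , # 7) ∷ []))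
  ∷
  ((- (+ 49 / 8)) , (8 , (# 0 , # 1) ∷ (# 0 , # 2) ∷ (# 0 , # 3) ∷ (# 1 , # 6) ∷ (# 1 , # 7) ∷ (# 2 , # 5) ∷ (# 2 , # 7) ∷ (# 3 , # 5) ∷ (# 3 , # 6) ∷ (# 4 , # 5) ∷ (# 4 , # 6) ∷ (# 4 , # 7) ∷ (# 5 , # 7) ∷ (# 6 , # 7) ∷ []))
  ∷
  ((+ 35 / 4) , (8 , (# 0 , # 1) ∷ (# 0 , # 2) ∷ (# 0 , # 7) ∷ (# 1 , # 4) ∷ (# 1 , # 6) ∷ (# 2 , # 3) ∷ (# 2 , # 5) ∷ (# 3 , # 6) ∷ (# 3 , # 7) ∷ (# 4 , # 5) ∷ (# 4 , # 7) ∷ (# 5 , # 6) ∷ (# 5 , # 7) ∷ (# 6 , # 7) ∷ []))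
  ∷
  ((- (+ 119 / 16)) , (8 , (# 0 , # 1) ∷ (# 0 , # 2) ∷ (# 0 , # 3) ∷ (# 1 , # 4) ∷ (# 1 , # 5) ∷ (# 2 , # 5) ∷ (# 2 , # 7) ∷ (# 3 , # 4) ∷ (# 3 , # 6) ∷ (# 4 , # 6) ∷ (# 4 , # 7) ∷ (# 5 , # 6) ∷ (# 5 , # 7) ∷ (# 6 , # 7) ∷ []))
  ∷
  ((+ 49 / 8) , (8 , (# 0 , # 1) ∷ (# 0 , # 2) ∷ (# 0 , # 4) ∷ (# 1 , # 3) ∷ (# 1 , # 7) ∷ (# 2 , # 5) ∷ (# 2 , # 7) ∷ (# 3 , # 6) ∷ (# 3 , # 7) ∷ (# 4 , # 5) ∷ (# 4 , # 6) ∷ (# 5 , # 6) ∷ (# 5 , # 7) ∷ (# 6 , # 7) ∷ []))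
  ∷
  ((+ 77 / 4) , (8 , (# 0 , # 1) ∷ (# 0 , # 2) ∷ (# 0 , # 3) ∷ (# 1 , # 2) ∷ (# 1 , # 7) ∷ (# 2 , # 6) ∷ (# 3 , # 5) ∷ (# 3 , # 7) ∷ (# 4 , # 5) ∷ (# 4 , # 6) ∷ (# 4 , # 7) ∷ (# 5 , # 6) ∷ (# 5 , # 7) ∷ (# 6 , # 7) ∷ []))
  ∷
  ((- (+ 49 / 8)) , (8 , (# 0 , # 1) ∷ (# 0 , # 4) ∷ (# 0 , # 6) ∷ (# 1 , # 4) ∷ (# 1 , # 5) ∷ (# 2 , # 4) ∷ (# 2 , # 5) ∷ (# 2 , # 7) ∷ (# 3 , # 4) ∷ (# 3 , # 6) ∷ (# 3 , # 7) ∷ (# 5 , # 6) ∷ (# 5 , # 7) ∷ (# 6 , # 7) ∷ []))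
  ∷
  ((- (+ 49 / 4)) , (8 , (# 0 , # 2) ∷ (# 0 , # 4) ∷ (# 0 , # 7) ∷ (# 1 , # 3) ∷ (# 1 , # 5) ∷ (# 1 , # 7) ∷ (# 2 , # 6) ∷ (# 2 , # 7) ∷ (# 3 , # 5) ∷ (# 3 , # 6) ∷ (# 4 , # 5) ∷ (# 4 , # 6) ∷ (# 5 , # 7) ∷ (# 6 , # 7) ∷ []))
  ∷
  ((- (+ 49 / 4)) , (8 , (# 0 , # 2) ∷ (# 0 , # 3) ∷ (# 0 , # 7) ∷ (# 1 , # 4) ∷ (# 1 , # 5) ∷ (# 1 , # 7) ∷ (# 2 , # 5) ∷ (# 2 , # 7) ∷ (# 3 , # 6) ∷ (# 3 , # 7) ∷ (# 4 , # 5) ∷ (# 4 , # 6) ∷ (# 5 , # 6) ∷ (# 6 , # 7) ∷ []))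
  ∷
  ((- (+ 7 / 1)) , (8 , (# 0 , # 1) ∷ (# 0 , # 3) ∷ (# 0 , # 7) ∷ (# 1 , # 2) ∷ (# 1 , # 7) ∷ (# 2 , # 4) ∷ (# 2 , # 6) ∷ (# 3 , # 5) ∷ (# 3 , # 7) ∷ (# 4 , # 5) ∷ (# 4 , # 6) ∷ (# 5 , # 6) ∷ (# 5 , # 7) ∷ (# 6 , # 7) ∷ []))
  ∷
  ((- (+ 7 / 1)) , (8 , (# 0 , # 1) ∷ (# 0 , # 3) ∷ (# 0 , # 7) ∷ (# 1 , # 2) ∷ (# 1 , # 7) ∷ (# 2 , # 5) ∷ (# 2 , # 7) ∷ (# 3 , # 5) ∷ (# 3 , # 6) ∷ (# 4 , # 5) ∷ (# 4 , # 6) ∷ (# 4 , # 7) ∷ (# 5 , # 6) ∷ (# 6 , # 7) ∷ []))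
  ∷
  ((+ 49 / 8) , (8 , (# 0 , # 1) ∷ (# 0 , # 4) ∷ (# 0 , # 5) ∷ (# 1 , # 4) ∷ (# 1 , # 6) ∷ (# 2 , # 4) ∷ (# 2 , # 5) ∷ (# 2 , # 7) ∷ (# 3 , # 5) ∷ (# 3 , # 6) ∷ (# 3 , # 7) ∷ (# 4 , # 7) ∷ (# 5 , # 6) ∷ (# 6 , # 7) ∷ []))
  ∷
  ((+ 49 / 8) , (8 , (# 0 , # 1) ∷ (# 0 , # 3) ∷ (# 0 , # 7) ∷ (# 1 , # 2) ∷ (# 1 , # 7) ∷ (# 2 , # 5) ∷ (# 2 , # 6) ∷ (# 3 , # 5) ∷ (# 3 , # 6) ∷ (# 4 , # 5) ∷ (# 4 , # 6) ∷ (# 4 , # 7) ∷ (# 5 , # 7) ∷ (# 6 , # 7) ∷ []))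
  ∷
  ((- (+ 7 / 1)) , (8 , (# 0 , # 1) ∷ (# 0 , # 2) ∷ (# 0 , # 4) ∷ (# 1 , # 5) ∷ (# 1 , # 6) ∷ (# 2 , # 4) ∷ (# 2 , # 5) ∷ (# 3 , # 4) ∷ (# 3 , # 6) ∷ (# 3 , # 7) ∷ (# 4 , # 7) ∷ (# 5 , # 6) ∷ (# 5 , # 7) ∷ (# 6 , # 7) ∷ []))
  ∷
  ((+ 7 / 1) , (8 , (# 0 , # 1) ∷ (# 0 , # 2) ∷ (# 0 , # 7) ∷ (# 1 , # 3) ∷ (# 1 , # 7) ∷ (# 2 , # 4) ∷ (# 2 , # 7) ∷ (# 3 , # 5) ∷ (# 3 , # 6) ∷ (# 4 , # 6) ∷ (# 4 , # 7) ∷ (# 5 , # 6) ∷ (# 5 , # 7) ∷ (# 6 , # 7) ∷ []))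
  ∷
  ((- (+ 7 / 1)) , (8 , (# 0 , # 1) ∷ (# 0 , # 2) ∷ (# 0 , # 7) ∷ (# 1 , # 4) ∷ (# 1 , # 5) ∷ (# 2 , # 6) ∷ (# 2 , # 7) ∷ (# 3 , # 4) ∷ (# 3 , # 5) ∷ (# 3 , # 6) ∷ (# 4 , # 5) ∷ (# 4 , # 6) ∷ (# 5 , # 7) ∷ (# 6 , # 7) ∷ []))
  ∷
  ((+ 77 / 8) , (8 , (# 0 , # 1) ∷ (# 0 , # 3) ∷ (# 0 , # 5) ∷ (# 1 , # 2) ∷ (# 1 , # 4) ∷ (# 2 , # 5) ∷ (# 2 , # 6) ∷ (# 3 , # 4) ∷ (# 3 , # 7) ∷ (# 4 , # 6) ∷ (# 4 , # 7) ∷ (# 5 , # 6) ∷ (# 5 , # 7) ∷ (# 6 , # 7) ∷ []))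
  ∷
  ((- (+ 7 / 1)) , (8 , (# 0 , # 2) ∷ (# 0 , # 5) ∷ (# 0 , # 6) ∷ (# 1 , # 3) ∷ (# 1 , # 4) ∷ (# 1 , # 5) ∷ (# 2 , # 4) ∷ (# 2 , # 6) ∷ (# 3 , # 4) ∷ (# 3 , # 7) ∷ (# 4 , # 7) ∷ (# 5 , # 6) ∷ (# 5 , # 7) ∷ (# 6 , # 7) ∷ []))
  ∷
  ((+ 49 / 4) , (8 , (# 0 , # 3) ∷ (# 0 , # 4) ∷ (# 0 , # 6) ∷ (# 1 , # 2) ∷ (# 1 , # 5) ∷ (# 1 , # 7) ∷ (# 2 , # 6) ∷ (# 2 , # 7) ∷ (# 3 , # 5) ∷ (# 3 , # 7) ∷ (# 4 , # 5) ∷ (# 4 , # 6) ∷ (# 5 , # 7) ∷ (# 6 , # 7) ∷ []))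
  ∷
  ((- (+ 147 / 8)) , (8 , (# 0 , # 1) ∷ (# 0 , # 5) ∷ (# 0 , # 7) ∷ (# 1 , # 6) ∷ (# 1 , # 7) ∷ (# 2 , # 3) ∷ (# 2 , # 5) ∷ (# 2 , # 7) ∷ (# 3 , # 5) ∷ (# 3 , # 6) ∷ (# 4 , # 5) ∷ (# 4 , # 6) ∷ (# 4 , # 7) ∷ (# 6 , # 7) ∷ []))
  ∷
  ((- (+ 21 / 8)) , (8 , (# 0 , # 1) ∷ (# 0 , # 4) ∷ (# 0 , # 5) ∷ (# 1 , # 6) ∷ (# 1 , # 7) ∷ (# 2 , # 4) ∷ (# 2 , # 5) ∷ (# 2 , # 7) ∷ (# 3 , # 4) ∷ (# 3 , # 5) ∷ (# 3 , # 6) ∷ (# 4 , # 6) ∷ (# 5 , # 7) ∷ (# 6 , # 7) ∷ []))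
  ∷
  ((- (+ 35 / 8)) , (8 , (# 0 , # 1) ∷ (# 0 , # 3) ∷ (# 0 , # 7) ∷ (# 1 , # 2) ∷ (# 1 , # 6) ∷ (# 2 , # 4) ∷ (# 2 , # 5) ∷ (# 3 , # 4) ∷ (# 3 , # 5) ∷ (# 4 , # 6) ∷ (# 4 , # 7) ∷ (# 5 , # 6) ∷ (# 5 , # 7) ∷ (# 6 , # 7) ∷ []))
  ∷
  ((- (+ 49 / 4)) , (8 , (# 0 , # 3) ∷ (# 0 , # 4) ∷ (# 0 , # 5) ∷ (# 1 , # 2) ∷ (# 1 , # 5) ∷ (# 1 , # 7) ∷ (# 2 , # 6) ∷ (# 2 , # 7) ∷ (# 3 , # 5) ∷ (# 3 , # 7) ∷ (# 4 , # 6) ∷ (# 4 , # 7) ∷ (# 5 , # 6) ∷ (# 6 , # 7) ∷ []))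
  ∷
  ((+ 105 / 8) , (8 , (# 0 , # 1) ∷ (# 0 , # 4) ∷ (# 0 , # 7) ∷ (# 1 , # 2) ∷ (# 1 , # 7) ∷ (# 2 , # 3) ∷ (# 2 , # 6) ∷ (# 3 , # 5) ∷ (# 3 , # 7) ∷ (# 4 , # 5) ∷ (# 4 , # 6) ∷ (# 5 , # 6) ∷ (# 5 , # 7) ∷ (# 6 , # 7) ∷ []))
  ∷
  ((- (+ 49 / 8)) , (8 , (# 0 , # 1) ∷ (# 0 , # 3) ∷ (# 0 , # 6) ∷ (# 1 , # 2) ∷ (# 1 , # 5) ∷ (# 2 , # 6) ∷ (# 2 , # 7) ∷ (# 3 , # 5) ∷ (# 3 , # 7) ∷ (# 4 , # 5) ∷ (# 4 , # 6) ∷ (# 4 , # 7) ∷ (# 5 , # 7) ∷ (# 6 , # 7) ∷ []))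
  ∷
  ((+ 49 / 16) , (8 , (# 0 , # 1) ∷ (# 0 , # 5) ∷ (# 0 , # 7) ∷ (# 1 , # 4) ∷ (# 1 , # 6) ∷ (# 2 , # 4) ∷ (# 2 , # 5) ∷ (# 2 , # 6) ∷ (# 3 , # 4) ∷ (# 3 , # 5) ∷ (# 3 , # 7) ∷ (# 4 , # 6) ∷ (# 5 , # 7) ∷ (# 6 , # 7) ∷ []))
  ∷
  ((+ 7 / 1) , (8 , (# 0 , # 1) ∷ (# 0 , # 2) ∷ (# 0 , # 7) ∷ (# 1 , # 4) ∷ (# 1 , # 6) ∷ (# 2 , # 4) ∷ (# 2 , # 5) ∷ (# 3 , # 5) ∷ (# 3 , # 6) ∷ (# 3 , # 7) ∷ (# 4 , # 5) ∷ (# 4 , # 6) ∷ (# 5 , # 7) ∷ (# 6 , # 7) ∷ []))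
  ∷
  ((- (+ 7 / 1)) , (8 , (# 0 , # 1) ∷ (# 0 , # 3) ∷ (# 0 , # 7) ∷ (# 1 , # 4) ∷ (# 1 , # 7) ∷ (# 2 , # 3) ∷ (# 2 , # 5) ∷ (# 2 , # 7) ∷ (# 3 , # 6) ∷ (# 4 , # 6) ∷ (# 4 , # 7) ∷ (# 5 , # 6) ∷ (# 5 , # 7) ∷ (# 6 , # 7) ∷ []))
  ∷
  ((- (+ 77 / 16)) , (8 , (# 0 , # 1) ∷ (# 0 , # 5) ∷ (# 0 , # 7) ∷ (# 1 , # 4) ∷ (# 1 , # 6) ∷ (# 2 , # 4) ∷ (# 2 , # 5) ∷ (# 2 , # 6) ∷ (# 3 , # 4) ∷ (# 3 , # 5) ∷ (# 3 , # 7) ∷ (# 4 , # 7) ∷ (# 5 , # 6) ∷ (# 6 , # 7) ∷ []))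
  ∷
  ((+ 77 / 4) , (8 , (# 0 , # 1) ∷ (# 0 , # 3) ∷ (# 0 , # 7) ∷ (# 1 , # 2) ∷ (# 1 , # 6) ∷ (# 2 , # 4) ∷ (# 2 , # 7) ∷ (# 3 , # 5) ∷ (# 3 , # 6) ∷ (# 4 , # 6) ∷ (# 4 , # 7) ∷ (# 5 , # 6) ∷ (# 5 , # 7) ∷ (# 6 , # 7) ∷ []))
  ∷
  ((+ 35 / 2) , (8 , (# 0 , # 1) ∷ (# 0 , # 3) ∷ (# 0 , # 4) ∷ (# 1 , # 2) ∷ (# 1 , # 6) ∷ (# 2 , # 5) ∷ (# 2 , # 7) ∷ (# 3 , # 5) ∷ (# 3 , # 7) ∷ (# 4 , # 6) ∷ (# 4 , # 7) ∷ (# 5 , # 6) ∷ (# 5 , # 7) ∷ (# 6 , # 7) ∷ []))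
  ∷
  ((- (+ 105 / 8)) , (8 , (# 0 , # 1) ∷ (# 0 , # 2) ∷ (# 0 , # 7) ∷ (# 1 , # 4) ∷ (# 1 , # 6) ∷ (# 2 , # 3) ∷ (# 2 , # 5) ∷ (# 3 , # 5) ∷ (# 3 , # 7) ∷ (# 4 , # 6) ∷ (# 4 , # 7) ∷ (# 5 , # 6) ∷ (# 5 , # 7) ∷ (# 6 , # 7) ∷ []))
  ∷
  ((- (+ 7 / 1)) , (8 , (# 0 , # 1) ∷ (# 0 , # 4) ∷ (# 0 , # 5) ∷ (# 1 , # 4) ∷ (# 1 , # 6) ∷ (# 2 , # 4) ∷ (# 2 , # 5) ∷ (# 2 , # 7) ∷ (# 3 , # 5) ∷ (# 3 , # 6) ∷ (# 3 , # 7) ∷ (# 4 , # 6) ∷ (# 5 , # 7) ∷ (# 6 , # 7) ∷ []))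
  ∷
  ((- (+ 147 / 16)) , (8 , (# 0 , # 1) ∷ (# 0 , # 2) ∷ (# 0 , # 5) ∷ (# 1 , # 4) ∷ (# 1 , # 7) ∷ (# 2 , # 3) ∷ (# 2 , # 6) ∷ (# 3 , # 6) ∷ (# 3 , # 7) ∷ (# 4 , # 6) ∷ (# 4 , # 7) ∷ (# 5 , # 6) ∷ (# 5 , # 7) ∷ (# 6 , # 7) ∷ []))
  ∷
  ((- (+ 77 / 4)) , (8 , (# 0 , # 1) ∷ (# 0 , # 2) ∷ (# 0 , # 6) ∷ (# 1 , # 4) ∷ (# 1 , # 5) ∷ (# 2 , # 4) ∷ (# 2 , # 6) ∷ (# 3 , # 4) ∷ (# 3 , # 5) ∷ (# 3 , # 7) ∷ (# 4 , # 7) ∷ (# 5 , # 6) ∷ (# 5 , # 7) ∷ (# 6 , # 7) ∷ []))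
  ∷
  ((- (+ 49 / 8)) , (8 , (# 0 , # 1) ∷ (# 0 , # 3) ∷ (# 0 , # 6) ∷ (# 1 , # 2) ∷ (# 1 , # 6) ∷ (# 2 , # 4) ∷ (# 2 , # 7) ∷ (# 3 , # 5) ∷ (# 3 , # 7) ∷ (# 4 , # 6) ∷ (# 4 , # 7) ∷ (# 5 , # 6) ∷ (# 5 , # 7) ∷ (# 6 , # 7) ∷ []))
  ∷
  ((- (+ 7 / 4)) , (8 , (# 0 , # 1) ∷ (# 0 , # 2) ∷ (# 0 , # 4) ∷ (# 1 , # 5) ∷ (# 1 , # 7) ∷ (# 2 , # 4) ∷ (# 2 , # 6) ∷ (# 3 , # 4) ∷ (# 3 , # 5) ∷ (# 3 , # 6) ∷ (# 4 , # 7) ∷ (# 5 , # 6) ∷ (# 5 , # 7) ∷ (# 6 , # 7) ∷ []))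
  ∷
  ((- (+ 7 / 1)) , (8 , (# 0 , # 1) ∷ (# 0 , # 3) ∷ (# 0 , # 7) ∷ (# 1 , # 2) ∷ (# 1 , # 5) ∷ (# 2 , # 5) ∷ (# 2 , # 7) ∷ (# 3 , # 6) ∷ (# 3 , # 7) ∷ (# 4 , # 5) ∷ (# 4 , # 6) ∷ (# 4 , # 7) ∷ (# 5 , # 6) ∷ (# 6 , # 7) ∷ []))
  ∷ []

{-# OPTIONS --safe #-}

-- For d γ₇ = 0, every term of d γ₇ is relabelled and its edges are sorted, with a sign, into a normal form.
-- A first normal form, which needs no search, cancels all terms with a vertex of degree 1 or 2 and identifies
-- the two orders of the halves of a split vertex; a list of permutations then brings each surviving
-- labelled graph to a canonical representative of its isomorphism class, or exhibits an odd automorphism of it,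
-- and the coefficients of each representative add up to zero.
--
-- For the second part, every edge of the heptagon wheel lies in a triangle, whereas the edge created by d in a simple
-- graph never does, so that d δ contains no wheel.  The wheel has no odd automorphism, so its coefficient is
-- a linear functional on the graph complex; it vanishes on d δ but not on γ₇, where the wheel occurs once.
module Submission where

open import Defs
open import Data.Bool using (Bool; true; false; if_then_else_; _∧_)
open import Data.Bool.Properties using (T-≡)
open import Data.Fin using (Fin; zero; suc; toℕ; fromℕ; inject₁; _↑ˡ_; _↑ʳ_; splitAt; punchIn; punchOut)
import Data.Fin.Properties as Finₚ
open import Data.Fin.Permutation using (Permutation′; _⟨$⟩ʳ_; _⟨$⟩ˡ_; inverseˡ; inverseʳ; insert; id)
open import Data.Integer using (ℤ; 0ℤ; 1ℤ; -1ℤ)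
import Data.Integer as ℤ
import Data.Integer.Properties as ℤₚ
open import Data.Integer.Tactic.RingSolver using () renaming (solve-∀ to ℤ-solve-∀)
open import Data.List using (List; []; _∷_; [_]; _++_; map; concatMap; length; filter; allFin)
open import Data.List.Properties using
  (++-assoc; ++-identityʳ; map-++; map-∘; map-cong; map-id; length-map; map-concatMap; concatMap-cong; length-filter)
import Data.List.Properties as Listₚ
open import Data.List.Membership.Propositional using (_∈_; find; lose)
open import Data.List.Membership.Propositional.Properties using (∈-map⁻; ∈-concatMap⁻; ∈-++⁺ʳ)
open import Data.List.Relation.Binary.Permutation.Propositional using (swap) renaming (refl to ↭-refl)
open import Data.List.Relation.Binary.Permutation.Propositional.Properties using (All-resp-↭; Any-resp-↭; ++⁺ˡ)
open import Data.List.Relation.Unary.All as All using (All; []; _∷_)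
import Data.List.Relation.Unary.All.Properties as Allₚ
open import Data.List.Relation.Unary.AllPairs as AllPairs using (AllPairs; []; _∷_; allPairs?)
import Data.List.Relation.Unary.AllPairs.Properties as AllPairsₚ
open import Data.List.Relation.Unary.Any as Any using (Any; here; there)
import Data.List.Relation.Unary.Any.Properties as Anyₚ
open import Data.Nat using (ℕ; zero; suc; _<ᵇ_; _≡ᵇ_)
import Data.Nat as ℕ
import Data.Nat.Properties as ℕₚ
open import Data.Nat.DivMod using (_mod_)
open import Data.Product using (Σ; _×_; _,_; proj₁; proj₂; ∃; ∃₂)
import Data.Product.Properties as ×ₚ
open import Data.Rational using (ℚ; ↥_; _/_; _+_; _*_; -_; 0ℚ; 1ℚ; ½)
open import Data.Rational.Properties using
  (_≟_; +-identityˡ; +-identityʳ; +-assoc; *-identityˡ; *-zeroˡ; *-zeroʳ; toℚᵘ-injective; toℚᵘ-homo-+; toℚᵘ-fromℚᵘ)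
open import Data.Rational.Solver using (module +-*-Solver)
import Data.Rational.Unnormalised as ℚᵘ
import Data.Rational.Unnormalised.Properties as ℚᵘₚ
open import Data.Sum using (_⊎_; inj₁; inj₂; [_,_]′)
open import Data.Unit using (⊤; tt)
open import Data.Vec using (lookup; tabulate)
open import Data.Vec.Properties using (lookup∘tabulate)
open import Function using (_∘_; _⇔_; mk⇔; module Equivalence)
open import Relation.Binary.Definitions using (Symmetric)
open import Relation.Binary.PropositionalEquality using
  (_≡_; _≢_; refl; sym; trans; cong; cong₂; subst; subst₂; module ≡-Reasoning)
open import Relation.Nullary using (¬_; Dec; yes; no; does; ¬?; contradiction)
open import Relation.Nullary.Decidable using (_×-dec_; _⊎-dec_; _→-dec_; does-⇔; dec-false; from-yes; from-no)
open import Algebra.Properties.Semiring.Sum ℤₚ.+-*-semiring using (sum; sum-cong-≗; *-distribˡ-sum)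
open import Algebra.Properties.CommutativeMonoid.Sum ℤₚ.+-0-commutativeMonoid using (sum-permute)
open ≡-Reasoning

-- The obstacle in the cocycle part is size: `d γ₇` expands into thousands of signed graphs, which
-- must cancel by evaluation inside the type checker. Soundness is therefore separated from success.
-- Every reduction is proved to be a consequence of the relations whatever permutation it uses, and
-- it is never proved that a normal form is canonical; that nothing is left over is one closed
-- equation, settled by `refl`. Hence isomorphisms can be found in advance and recorded as bare
-- numbers, and the data are shaped for evaluation: integer numerators, natural numbers for edges, a
-- search tree for collecting like terms.
--
-- In the second part the functional has to respect the relations on all labelled graphs, of any
-- size. Choosing one isomorphism with the wheel would make this awkward; `φ` instead sums over all
-- ways of seeing a wheel in the graph, so that invariance is a reindexing of sums, and its value on
-- `γ₇` is again left to evaluation.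

private variable
  n : ℕ

-- Linear combinations and relations

δ : LGraph → LGraph → ℚ
δ H G with G ≟G H
... | yes _ = 1ℚ
... | no _ = 0ℚ

coeff-∷ : ∀ q G x H → coeff ((q , G) ∷ x) H ≡ q * δ H G + coeff x H
coeff-∷ q G x H with G ≟G H
... | yes _ = solve 2 (λ q c → q :+ c := q :* con 1ℚ :+ c) refl q (coeff x H)
  where open +-*-Solver
... | no _ = solve 2 (λ q c → c := q :* con 0ℚ :+ c) refl q (coeff x H)
  where open +-*-Solver

coeff-++ : ∀ x y H → coeff (x ++ y) H ≡ coeff x H + coeff y H
coeff-++ [] y H = sym (+-identityˡ _)
coeff-++ ((q , G) ∷ x) y H = begin
  coeff ((q , G) ∷ x ++ y) H              ≡⟨ coeff-∷ q G (x ++ y) H ⟩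
  q * δ H G + coeff (x ++ y) H            ≡⟨ cong ((q * δ H G) +_) (coeff-++ x y H) ⟩
  q * δ H G + (coeff x H + coeff y H)     ≡⟨ +-assoc (q * δ H G) (coeff x H) (coeff y H) ⟨
  q * δ H G + coeff x H + coeff y H       ≡⟨ cong (_+ coeff y H) (coeff-∷ q G x H) ⟨
  coeff ((q , G) ∷ x) H + coeff y H       ∎

coeff-scale : ∀ c x H → coeff (scale c x) H ≡ c * coeff x H
coeff-scale c [] H = solve 1 (λ c → con 0ℚ := c :* con 0ℚ) refl c
  where open +-*-Solver
coeff-scale c ((q , G) ∷ x) H = begin
  coeff (scale c ((q , G) ∷ x)) H       ≡⟨ coeff-∷ (c * q) G (scale c x) H ⟩
  c * q * δ H G + coeff (scale c x) H   ≡⟨ cong ((c * q * δ H G) +_) (coeff-scale c x H) ⟩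
  c * q * δ H G + c * coeff x H
    ≡⟨ solve 4 (λ c q i k → c :* q :* i :+ c :* k := c :* (q :* i :+ k)) refl c q (δ H G) (coeff x H) ⟩
  c * (q * δ H G + coeff x H)           ≡⟨ cong (c *_) (coeff-∷ q G x H) ⟨
  c * coeff ((q , G) ∷ x) H             ∎
  where open +-*-Solver

eval : (LGraph → ℚ) → Combo → ℚ
eval w [] = 0ℚ
eval w ((q , G) ∷ x) = q * w G + eval w x

eval-++ : ∀ w x y → eval w (x ++ y) ≡ eval w x + eval w y
eval-++ w [] y = sym (+-identityˡ _)
eval-++ w ((q , G) ∷ x) y = trans (cong ((q * w G) +_) (eval-++ w x y)) (sym (+-assoc (q * w G) _ _))

eval-scale : ∀ w c x → eval w (scale c x) ≡ c * eval w x
eval-scale w c [] = solve 1 (λ c → con 0ℚ := c :* con 0ℚ) refl c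
  where open +-*-Solver
eval-scale w c ((q , G) ∷ x) = trans (cong ((c * q * w G) +_) (eval-scale w c x))
  (solve 4 (λ c q i k → c :* q :* i :+ c :* k := c :* (q :* i :+ k)) refl c q (w G) (eval w x))
  where open +-*-Solver

eval-vanish : ∀ w {x} → All (λ qG → w (proj₂ qG) ≡ 0ℚ) x → eval w x ≡ 0ℚ
eval-vanish w [] = refl
eval-vanish w {(q , G) ∷ x} (wG≡0 ∷ ws) = begin
  q * w G + eval w x  ≡⟨ cong₂ (λ a b → q * a + b) wG≡0 (eval-vanish w ws) ⟩
  q * 0ℚ + 0ℚ         ≡⟨ solve 1 (λ q → q :* con 0ℚ :+ con 0ℚ := con 0ℚ) refl q ⟩
  0ℚ                  ∎
  where open +-*-Solver

without : LGraph → Combo → Combo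
without G = filter (λ qK → ¬? (proj₂ qK ≟G G))

eval-without : ∀ w G x → eval w x ≡ coeff x G * w G + eval w (without G x)
eval-without w G [] = solve 1 (λ i → con 0ℚ := con 0ℚ :* i :+ con 0ℚ) refl (w G)
  where open +-*-Solver
eval-without w G ((q , K) ∷ x) with K ≟G G | eval-without w G x
... | yes refl | ih = trans (cong ((q * w G) +_) ih)
  (solve 4 (λ q i c r → q :* i :+ (c :* i :+ r) := (q :+ c) :* i :+ r) refl q (w G) (coeff x G) _)
  where open +-*-Solver
... | no _ | ih = trans (cong ((q * w K) +_) ih)
  (solve 3 (λ a b r → a :+ (b :+ r) := b :+ (a :+ r)) refl (q * w K) (coeff x G * w G) _)
  where open +-*-Solver

coeff-without-≡ : ∀ G x → coeff (without G x) G ≡ 0ℚ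
coeff-without-≡ G [] = refl
coeff-without-≡ G ((q , K) ∷ x) with K ≟G G
... | yes _ = coeff-without-≡ G x
... | no K≢G with K ≟G G
...   | yes K≡G = contradiction K≡G K≢G
...   | no _ = coeff-without-≡ G x

coeff-without-≢ : ∀ G x {H} → H ≢ G → coeff (without G x) H ≡ coeff x H
coeff-without-≢ G [] H≢G = refl
coeff-without-≢ G ((q , K) ∷ x) {H} H≢G with K ≟G G
... | yes refl with G ≟G H
...   | yes G≡H = contradiction (sym G≡H) H≢G
...   | no _ = coeff-without-≢ G x H≢G
coeff-without-≢ G ((q , K) ∷ x) {H} H≢G | no _ with K ≟G H
... | yes _ = cong (q +_) (coeff-without-≢ G x H≢G)
... | no _ = coeff-without-≢ G x H≢G

without-shorter : ∀ q G x → length (without G ((q , G) ∷ x)) ℕ.≤ length x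
without-shorter q G x with G ≟G G
... | yes _ = length-filter _ x
... | no G≢G = contradiction refl G≢G

-- A graph may occur several times in the list, so the terms do not vanish one by one. All
-- occurrences of the first graph `G` are removed together: they contribute `coeff x G * w G`, which
-- is zero, and the remaining list still has zero coefficients. It is not a sublist by structure,
-- whence the bound `n` on the length.
eval-null : ∀ w x → (∀ H → coeff x H ≡ 0ℚ) → eval w x ≡ 0ℚ
eval-null w x = go (length x) x ℕₚ.≤-refl
  where
  go : ∀ n x → length x ℕ.≤ n → (∀ H → coeff x H ≡ 0ℚ) → eval w x ≡ 0ℚ
  go n [] _ _ = refl
  go (suc n) x@((q , G) ∷ x′) (ℕ.s≤s len) null = begin
    eval w x                                 ≡⟨ eval-without w G x ⟩
    coeff x G * w G + eval w (without G x)
      ≡⟨ cong₂ (λ a b → a * w G + b) (null G) (go n (without G x) (ℕₚ.≤-trans (without-shorter q G x′) len) null′) ⟩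
    0ℚ * w G + 0ℚ                            ≡⟨ trans (+-identityʳ _) (*-zeroˡ (w G)) ⟩
    0ℚ                                       ∎
    where
    null′ : ∀ H → coeff (without G x) H ≡ 0ℚ
    null′ H with H ≟G G
    ... | yes refl = coeff-without-≡ G x
    ... | no H≢G = trans (coeff-without-≢ G x H≢G) (null H)

eval-cong : ∀ w x y → (∀ H → coeff x H ≡ coeff y H) → eval w x ≡ eval w y
eval-cong w x y x≐y = begin
  eval w x
    ≡⟨ solve 2 (λ a b → a := (a :+ con (- 1ℚ) :* b) :+ b) refl (eval w x) (eval w y) ⟩
  (eval w x + (- 1ℚ) * eval w y) + eval w y   ≡⟨ cong (_+ eval w y) difference ⟩
  0ℚ + eval w y                               ≡⟨ +-identityˡ _ ⟩
  eval w y                                    ∎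
  where
  open +-*-Solver
  null : ∀ H → coeff (x − y) H ≡ 0ℚ
  null H = begin
    coeff (x − y) H                            ≡⟨ coeff-++ x (scale (- 1ℚ) y) H ⟩
    coeff x H + coeff (scale (- 1ℚ) y) H       ≡⟨ cong₂ _+_ (x≐y H) (coeff-scale (- 1ℚ) y H) ⟩
    coeff y H + (- 1ℚ) * coeff y H             ≡⟨ solve 1 (λ a → a :+ con (- 1ℚ) :* a := con 0ℚ) refl (coeff y H) ⟩
    0ℚ                                         ∎
  difference : eval w x + (- 1ℚ) * eval w y ≡ 0ℚ
  difference = begin
    eval w x + (- 1ℚ) * eval w y          ≡⟨ cong (eval w x +_) (eval-scale w (- 1ℚ) y) ⟨
    eval w x + eval w (scale (- 1ℚ) y)    ≡⟨ eval-++ w x _ ⟨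
    eval w (x − y)                        ≡⟨ eval-null w (x − y) null ⟩
    0ℚ                                    ∎

Relations : Set
Relations = List (ℚ × Σ Move (λ m → Simple (source m)))

total : Relations → Combo
total [] = []
total ((q , m , _) ∷ rs) = scale q (relation m) ++ total rs

total-++ : ∀ rs ss H → coeff (total (rs ++ ss)) H ≡ coeff (total rs) H + coeff (total ss) H
total-++ [] ss H = sym (+-identityˡ _)
total-++ ((q , m , _) ∷ rs) ss H = begin
  coeff (scale q (relation m) ++ total (rs ++ ss)) H                          ≡⟨ coeff-++ (scale q (relation m)) _ H ⟩
  coeff (scale q (relation m)) H + coeff (total (rs ++ ss)) H
    ≡⟨ cong (coeff (scale q (relation m)) H +_) (total-++ rs ss H) ⟩
  coeff (scale q (relation m)) H + (coeff (total rs) H + coeff (total ss) H)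
    ≡⟨ +-assoc (coeff (scale q (relation m)) H) _ _ ⟨
  coeff (scale q (relation m)) H + coeff (total rs) H + coeff (total ss) H
    ≡⟨ cong (_+ coeff (total ss) H) (coeff-++ (scale q (relation m)) _ H) ⟨
  coeff (scale q (relation m) ++ total rs) H + coeff (total ss) H             ∎

rescale : ℚ → Relations → Relations
rescale c = map (λ qm → c * proj₁ qm , proj₂ qm)

total-rescale : ∀ c rs H → coeff (total (rescale c rs)) H ≡ c * coeff (total rs) H
total-rescale c [] H = solve 1 (λ c → con 0ℚ := c :* con 0ℚ) refl c
  where open +-*-Solver
total-rescale c ((q , m , _) ∷ rs) H = begin
  coeff (scale (c * q) (relation m) ++ total (rescale c rs)) H
    ≡⟨ coeff-++ (scale (c * q) (relation m)) _ H ⟩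
  coeff (scale (c * q) (relation m)) H + coeff (total (rescale c rs)) H
    ≡⟨ cong₂ _+_ (coeff-scale (c * q) (relation m) H) (total-rescale c rs H) ⟩
  c * q * coeff (relation m) H + c * coeff (total rs) H
    ≡⟨ solve 4 (λ c q r t → c :* q :* r :+ c :* t := c :* (q :* r :+ t)) refl c q (coeff (relation m) H) _ ⟩
  c * (q * coeff (relation m) H + coeff (total rs) H)
    ≡⟨ cong (λ a → c * (a + coeff (total rs) H)) (coeff-scale q (relation m) H) ⟨
  c * (coeff (scale q (relation m)) H + coeff (total rs) H)
    ≡⟨ cong (c *_) (coeff-++ (scale q (relation m)) _ H) ⟨
  c * coeff (scale q (relation m) ++ total rs) H                         ∎
  where open +-*-Solver

infix 4 _≈_

_≈_ : Combo → Combo → Set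
x ≈ y = Σ Relations λ rs → ∀ H → coeff x H ≡ coeff y H + coeff (total rs) H

-- The function under `concatMap` in `IsZero` is an anonymous pattern-matching lambda, which cannot
-- be written down a second time as an equal term. Unification supplies it as `f`, and only its
-- values on tuples are compared.
≈[]⇒IsZero : ∀ {x} → x ≈ [] → IsZero x
≈[]⇒IsZero {x} (rs , x≐rs) = rs , λ H → begin
  coeff x H                ≡⟨ x≐rs H ⟩
  0ℚ + coeff (total rs) H  ≡⟨ +-identityˡ _ ⟩
  coeff (total rs) H       ≡⟨ cong (λ y → coeff y H) (total-concatMap rs (λ _ _ _ → refl)) ⟩
  _                        ∎
  where
  total-concatMap : ∀ {f} rs → (∀ q m s → scale q (relation m) ≡ f (q , m , s)) → total rs ≡ concatMap f rs
  total-concatMap [] _ = refl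
  total-concatMap ((q , m , s) ∷ rs) ≗f = cong₂ _++_ (≗f q m s) (total-concatMap rs ≗f)

IsZero⇒total : ∀ {x} → IsZero x → ∃ λ rs → ∀ H → coeff x H ≡ coeff (total rs) H
IsZero⇒total (rs , x≐rs) = rs , λ H → trans (x≐rs H) (cong (λ y → coeff y H) (concatMap-total rs (λ _ _ _ → refl)))
  where
  concatMap-total : ∀ {f} rs → (∀ q m s → f (q , m , s) ≡ scale q (relation m)) → concatMap f rs ≡ total rs
  concatMap-total [] _ = refl
  concatMap-total ((q , m , s) ∷ rs) f≗ = cong₂ _++_ (f≗ q m s) (concatMap-total rs f≗)

≐⇒≈ : ∀ x y → (∀ H → coeff x H ≡ coeff y H) → x ≈ y
≐⇒≈ x y x≐y = [] , λ H → trans (x≐y H) (sym (+-identityʳ _))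

≈-refl : ∀ {x} → x ≈ x
≈-refl {x} = ≐⇒≈ x x λ _ → refl

≈-trans : ∀ {x y z} → x ≈ y → y ≈ z → x ≈ z
≈-trans {x} {y} {z} (rs , x≐) (ss , y≐) = ss ++ rs , λ H → begin
  coeff x H                                                ≡⟨ x≐ H ⟩
  coeff y H + coeff (total rs) H                           ≡⟨ cong (_+ coeff (total rs) H) (y≐ H) ⟩
  coeff z H + coeff (total ss) H + coeff (total rs) H      ≡⟨ +-assoc (coeff z H) _ _ ⟩
  coeff z H + (coeff (total ss) H + coeff (total rs) H)    ≡⟨ cong (coeff z H +_) (total-++ ss rs H) ⟨
  coeff z H + coeff (total (ss ++ rs)) H                   ∎

≈-++ : ∀ {x y x′ y′} → x ≈ y → x′ ≈ y′ → x ++ x′ ≈ y ++ y′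
≈-++ {x} {y} {x′} {y′} (rs , x≐) (ss , x′≐) = rs ++ ss , λ H → begin
  coeff (x ++ x′) H                                                          ≡⟨ coeff-++ x x′ H ⟩
  coeff x H + coeff x′ H                                                     ≡⟨ cong₂ _+_ (x≐ H) (x′≐ H) ⟩
  (coeff y H + coeff (total rs) H) + (coeff y′ H + coeff (total ss) H)
    ≡⟨ solve 4 (λ a b c d → (a :+ b) :+ (c :+ d) := (a :+ c) :+ (b :+ d)) refl (coeff y H) _ _ _ ⟩
  (coeff y H + coeff y′ H) + (coeff (total rs) H + coeff (total ss) H)
    ≡⟨ cong₂ _+_ (coeff-++ y y′ H) (total-++ rs ss H) ⟨
  coeff (y ++ y′) H + coeff (total (rs ++ ss)) H                             ∎
  where open +-*-Solver

-- An odd automorphism identifies a term with its negative, so twice the term is a combination of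
-- relations; with rational coefficients that combination can be halved.
≈-neg⇒≈[] : ∀ q G → [ q , G ] ≈ [ - q , G ] → [ q , G ] ≈ []
≈-neg⇒≈[] q G (rs , q≐) = rescale ½ rs , λ H → begin
  coeff [ q , G ] H                                              ≡⟨ coeff-∷ q G [] H ⟩
  q * δ H G + 0ℚ
    ≡⟨ solve 3 (λ q i r → q :* i :+ con 0ℚ := con ½ :* ((q :* i :+ con 0ℚ) :+ (q :* i :+ con 0ℚ))) refl q (δ H G) 0ℚ ⟩
  ½ * ((q * δ H G + 0ℚ) + (q * δ H G + 0ℚ))
    ≡⟨ cong (λ a → ½ * (a + (q * δ H G + 0ℚ)))
         (trans (sym (coeff-∷ q G [] H)) (trans (q≐ H) (cong (_+ coeff (total rs) H) (coeff-∷ (- q) G [] H)))) ⟩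
  ½ * ((- q * δ H G + 0ℚ + coeff (total rs) H) + (q * δ H G + 0ℚ))
    ≡⟨ solve 3 (λ q i t → con ½ :* ((:- q :* i :+ con 0ℚ :+ t) :+ (q :* i :+ con 0ℚ)) := con 0ℚ :+ con ½ :* t)
       refl q (δ H G) (coeff (total rs) H) ⟩
  0ℚ + ½ * coeff (total rs) H                                    ≡⟨ cong (0ℚ +_) (total-rescale ½ rs H) ⟨
  0ℚ + coeff (total (rescale ½ rs)) H                            ∎
  where open +-*-Solver

opaque
  -- ι z is z/16: 16 is a common denominator of the coefficients of γ₇.
  ι : ℤ → ℚ
  ι z = z / 16

  ι-0 : ι (ℤ.+ 0) ≡ 0ℚ
  ι-0 = refl

  ι-+ : ∀ a b → ι (a ℤ.+ b) ≡ ι a + ι b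
  -- `_/_` cancels common factors, so the fractions are compared unnormalised, by cross-multiplying
  -- the denominators 16 and 16 · 16.
  ι-+ a b = toℚᵘ-injective (ℚᵘₚ.≃-trans (toℚᵘ-fromℚᵘ (ℚᵘ.mkℚᵘ (a ℤ.+ b) 15))
    (ℚᵘₚ.≃-sym (ℚᵘₚ.≃-trans (toℚᵘ-homo-+ (ι a) (ι b))
    (ℚᵘₚ.≃-trans (ℚᵘₚ.+-cong (toℚᵘ-fromℚᵘ (ℚᵘ.mkℚᵘ a 15)) (toℚᵘ-fromℚᵘ (ℚᵘ.mkℚᵘ b 15))) (ℚᵘ.*≡* (common a b))))))
    where
    common : ∀ a b → (a ℤ.* ℤ.+ 16 ℤ.+ b ℤ.* ℤ.+ 16) ℤ.* ℤ.+ 16 ≡ (a ℤ.+ b) ℤ.* ℤ.+ 256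
    common = ℤ-solve-∀

ι-neg : ∀ a → ι (ℤ.- a) ≡ - ι a
ι-neg a = begin
  ι (ℤ.- a)                  ≡⟨ solve 2 (λ x y → x := (x :+ y) :+ :- y) refl (ι (ℤ.- a)) (ι a) ⟩
  (ι (ℤ.- a) + ι a) + - ι a  ≡⟨ cong (_+ - ι a) (trans (sym (ι-+ (ℤ.- a) a)) (trans (cong ι (ℤₚ.+-inverseˡ a)) ι-0)) ⟩
  0ℚ + - ι a                 ≡⟨ +-identityˡ _ ⟩
  - ι a                      ∎
  where open +-*-Solver

-- Normal forms of edge lists

SameEdge-sym : {e e′ : Edge n} → SameEdge e e′ → SameEdge e′ e
SameEdge-sym (inj₁ (refl , refl)) = inj₁ (refl , refl)
SameEdge-sym (inj₂ (refl , refl)) = inj₂ (refl , refl)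

SameEdge-flipˡ : ∀ {a b : Fin n} {e} → SameEdge (a , b) e → SameEdge (b , a) e
SameEdge-flipˡ (inj₁ (refl , refl)) = inj₂ (refl , refl)
SameEdge-flipˡ (inj₂ (refl , refl)) = inj₁ (refl , refl)

SameEdge-flipʳ : ∀ {a b : Fin n} {e} → SameEdge e (a , b) → SameEdge e (b , a)
SameEdge-flipʳ = SameEdge-sym ∘ SameEdge-flipˡ ∘ SameEdge-sym

sameEdge? : (e e′ : Edge n) → Dec (SameEdge e e′)
sameEdge? (a , b) (c , d) = (a Finₚ.≟ c ×-dec b Finₚ.≟ d) ⊎-dec (a Finₚ.≟ d ×-dec b Finₚ.≟ c)

module _ {A : Set} {R : A → A → Set} where

  AllPairs-swap : Symmetric R → ∀ xs {a b ys} → AllPairs R (xs ++ a ∷ b ∷ ys) → AllPairs R (xs ++ b ∷ a ∷ ys)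
  AllPairs-swap R-sym [] ((ab ∷ as) ∷ bs ∷ ps) = (R-sym ab ∷ bs) ∷ as ∷ ps
  AllPairs-swap R-sym (x ∷ xs) {a} {b} (rs ∷ ps) = All-resp-↭ (++⁺ˡ xs (swap a b ↭-refl)) rs ∷ AllPairs-swap R-sym xs ps

  AllPairs-replace : ∀ {e e′} → (∀ {x} → R e x → R e′ x) → (∀ {x} → R x e → R x e′) →
                     ∀ xs {ys} → AllPairs R (xs ++ e ∷ ys) → AllPairs R (xs ++ e′ ∷ ys)
  AllPairs-replace f g [] (rs ∷ ps) = All.map f rs ∷ ps
  AllPairs-replace f g (x ∷ xs) (rs ∷ ps) with Allₚ.++⁻ xs rs
  ... | rs₁ , r ∷ rs₂ = Allₚ.++⁺ rs₁ (g r ∷ rs₂) ∷ AllPairs-replace f g xs ps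

swap-Simple : ∀ (xs : Edges n) {a b ys} → Simple (n , xs ++ a ∷ b ∷ ys) → Simple (n , xs ++ b ∷ a ∷ ys)
swap-Simple xs {a} {b} (loopless , distinct) =
  All-resp-↭ (++⁺ˡ xs (swap a b ↭-refl)) loopless , AllPairs-swap (_∘ SameEdge-sym) xs distinct

flip-Simple : ∀ (xs : Edges n) {a b ys} → Simple (n , xs ++ (a , b) ∷ ys) → Simple (n , xs ++ (b , a) ∷ ys)
flip-Simple xs (loopless , distinct) with Allₚ.++⁻ xs loopless
... | l₁ , l ∷ l₂ = Allₚ.++⁺ l₁ (l ∘ sym ∷ l₂) , AllPairs-replace (_∘ SameEdge-flipˡ) (_∘ SameEdge-flipʳ) xs distinct

⟨$⟩ʳ-injective : ∀ (π : Permutation′ n) {i j} → π ⟨$⟩ʳ i ≡ π ⟨$⟩ʳ j → i ≡ j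
⟨$⟩ʳ-injective π eq = trans (sym (inverseˡ π)) (trans (cong (π ⟨$⟩ˡ_) eq) (inverseˡ π))

SameEdge-relabel⁻ : ∀ (π : Permutation′ n) {a b c d} →
  SameEdge (π ⟨$⟩ʳ a , π ⟨$⟩ʳ b) (π ⟨$⟩ʳ c , π ⟨$⟩ʳ d) → SameEdge (a , b) (c , d)
SameEdge-relabel⁻ π (inj₁ (p , q)) = inj₁ (⟨$⟩ʳ-injective π p , ⟨$⟩ʳ-injective π q)
SameEdge-relabel⁻ π (inj₂ (p , q)) = inj₂ (⟨$⟩ʳ-injective π p , ⟨$⟩ʳ-injective π q)

relabel-Simple : ∀ (π : Permutation′ n) {es} → Simple (n , es) → Simple (n , relabelEdges π es)
relabel-Simple π (loopless , distinct) =
  Allₚ.map⁺ (All.map (_∘ ⟨$⟩ʳ-injective π) loopless) ,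
  AllPairsₚ.map⁺ (AllPairs.map (_∘ SameEdge-relabel⁻ π) distinct)

-- The three kinds of relation differ only in the sign `ε`: adding `q` times the relation `S + ε T`
-- trades `q S` for `- (q * ε) T`.
move-≈ : ∀ q {q′ ε S T} m → Simple (source m) → relation m ≡ (1ℚ , S) ∷ (ε , T) ∷ [] →
         q′ ≡ - (q * ε) → [ q , S ] ≈ [ q′ , T ]
move-≈ q {q′} {ε} {S} {T} m s eq q′≡ = (q , m , s) ∷ [] , λ H → begin
  coeff [ q , S ] H          ≡⟨ coeff-∷ q S [] H ⟩
  q * δ H S + 0ℚ             ≡⟨ solve 4 (λ q ε s t → q :* s :+ con 0ℚ :=
                                  (:- (q :* ε) :* t :+ con 0ℚ) :+ (q :* (con 1ℚ :* s :+ (ε :* t :+ con 0ℚ)) :+ con 0ℚ))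
                                  refl q ε (δ H S) (δ H T) ⟩
  (- (q * ε) * δ H T + 0ℚ) + (q * (1ℚ * δ H S + (ε * δ H T + 0ℚ)) + 0ℚ)
    ≡⟨ cong₂ _+_ (trans (cong (λ c → c * δ H T + 0ℚ) (sym q′≡)) (sym (coeff-∷ q′ T [] H)))
                 (cong (λ r → q * r + 0ℚ) (sym (trans (coeff-∷ 1ℚ S _ H) (cong (λ r → 1ℚ * δ H S + r) (coeff-∷ ε T [] H))))) ⟩
  coeff [ q′ , T ] H + (q * coeff ((1ℚ , S) ∷ (ε , T) ∷ []) H + 0ℚ)
    ≡⟨ cong (λ x → coeff [ q′ , T ] H + (q * coeff x H + 0ℚ)) (sym eq) ⟩
  coeff [ q′ , T ] H + (q * coeff (relation m) H + 0ℚ)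
    ≡⟨ cong (λ r → coeff [ q′ , T ] H + (r + 0ℚ)) (coeff-scale q (relation m) H) ⟨
  coeff [ q′ , T ] H + (coeff (scale q (relation m)) H + 0ℚ)
    ≡⟨ cong (coeff [ q′ , T ] H +_) (coeff-++ (scale q (relation m)) [] H) ⟨
  coeff [ q′ , T ] H + coeff (total ((q , m , s) ∷ [])) H  ∎
  where open +-*-Solver

-- Reductions of single terms modulo the relations

Term : ℕ → Set
Term n = ℤ × Edges n

⟪_⟫ : Term n → Combo
⟪ z , es ⟫ = [ ι z , (_ , es) ]

infix 4 _⟶_

-- `IsZero` admits a relation only if its source is simple, so each reduction must hand simplicity
-- on to the next one.
record _⟶_ (t t′ : Term n) : Set where
  constructor reduces
  field
    apply : Simple (_ , proj₂ t) → Simple (_ , proj₂ t′) × ⟪ t ⟫ ≈ ⟪ t′ ⟫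
open _⟶_

⟶-refl : {t : Term n} → t ⟶ t
⟶-refl {t = t} .apply s = s , ≈-refl {⟪ t ⟫}

⟶-trans : {t t′ t″ : Term n} → t ⟶ t′ → t′ ⟶ t″ → t ⟶ t″
⟶-trans {t = t} {t′} {t″} f g .apply s =
  let s′ , p = apply f s
      s″ , q = apply g s′
  in s″ , ≈-trans {⟪ t ⟫} {⟪ t′ ⟫} {⟪ t″ ⟫} p q

⟶-relabel : ∀ (π : Permutation′ n) z es → (z , es) ⟶ (z , relabelEdges π es)
⟶-relabel π z es .apply s = relabel-Simple π s , move-≈ (ι z) (relabel _ es π) s refl
  (solve 1 (λ q → q := :- (q :* con (- 1ℚ))) refl (ι z))
  where open +-*-Solver

⟶-swap : ∀ z (xs : Edges n) {a b ys} → (z , xs ++ a ∷ b ∷ ys) ⟶ (ℤ.- z , xs ++ b ∷ a ∷ ys)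
⟶-swap z xs .apply s = swap-Simple xs s , move-≈ (ι z) (swapE _ xs _ _ _) s refl
  (trans (ι-neg z) (solve 1 (λ q → :- q := :- (q :* con 1ℚ)) refl (ι z)))
  where open +-*-Solver

⟶-flip : ∀ z (xs : Edges n) {a b ys} → (z , xs ++ (a , b) ∷ ys) ⟶ (z , xs ++ (b , a) ∷ ys)
⟶-flip z xs .apply s = flip-Simple xs s , move-≈ (ι z) (flipE _ xs _ _ _) s refl
  (solve 1 (λ q → q := :- (q :* con (- 1ℚ))) refl (ι z))
  where open +-*-Solver

-- These moves ignore the edges to their left, unlike relabelling, and so apply below any prefix.
infix 4 _↝_

data _↝_ {n} : Term n → Term n → Set where
  ↝-refl  : ∀ {t} → t ↝ t
  ↝-trans : ∀ {t t′ t″} → t ↝ t′ → t′ ↝ t″ → t ↝ t″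
  ↝-flip  : ∀ {z a b es} → (z , (a , b) ∷ es) ↝ (z , (b , a) ∷ es)
  ↝-swap  : ∀ {z e e′ es} → (z , e ∷ e′ ∷ es) ↝ (ℤ.- z , e′ ∷ e ∷ es)
  ↝-∷     : ∀ {z z′ es es′} e → (z , es) ↝ (z′ , es′) → (z , e ∷ es) ↝ (z′ , e ∷ es′)

↝⇒⟶ : ∀ {z z′} {es es′ : Edges n} xs → (z , es) ↝ (z′ , es′) → (z , xs ++ es) ⟶ (z′ , xs ++ es′)
↝⇒⟶ xs ↝-refl = ⟶-refl
↝⇒⟶ xs (↝-trans p q) = ⟶-trans (↝⇒⟶ xs p) (↝⇒⟶ xs q)
↝⇒⟶ xs ↝-flip = ⟶-flip _ xs
↝⇒⟶ xs ↝-swap = ⟶-swap _ xs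
↝⇒⟶ {z = z} {z′} {_ ∷ es} {_ ∷ es′} xs (↝-∷ e p) =
  subst₂ (λ fs fs′ → (z , fs) ⟶ (z′ , fs′)) (++-assoc xs [ e ] es) (++-assoc xs [ e ] es′) (↝⇒⟶ (xs ++ [ e ]) p)

-- A key lists edges by their codes 9a + b with a < b.
Key : Set
Key = List ℕ

code : ℕ → ℕ → ℕ
code a b = if a <ᵇ b then 9 ℕ.* a ℕ.+ b else 9 ℕ.* b ℕ.+ a

decode : ℕ → Edge 9
decode c = (c ℕ./ 9) mod 9 , c mod 9

decode-code : ∀ a b → decode (code (toℕ a) (toℕ b)) ≡ (a , b) ⊎ decode (code (toℕ a) (toℕ b)) ≡ (b , a)
decode-code = from-yes (Finₚ.all? λ a → Finₚ.all? λ b →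
  (decode (code (toℕ a) (toℕ b)) ≟E (a , b)) ⊎-dec (decode (code (toℕ a) (toℕ b)) ≟E (b , a)))
  where _≟E_ = ×ₚ.≡-dec Finₚ._≟_ Finₚ._≟_

decodeAll : ℤ × Key → Term 9
decodeAll (z , k) = z , map decode k

-- Insertion sort only exchanges neighbouring edges, so the sign of the sorting permutation is
-- obtained by one negation per edge that is passed.
insertCode : ℤ → ℕ → Key → ℤ × Key
insertCode z c [] = z , [ c ]
insertCode z c (c′ ∷ k) with c <ᵇ c′
... | true = z , c ∷ c′ ∷ k
... | false with insertCode (ℤ.- z) c k
...   | z′ , k′ = z′ , c′ ∷ k′

insertCode-↝ : ∀ z c k → (z , decode c ∷ map decode k) ↝ decodeAll (insertCode z c k)
insertCode-↝ z c [] = ↝-refl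
insertCode-↝ z c (c′ ∷ k) with c <ᵇ c′
... | true = ↝-refl
... | false with insertCode (ℤ.- z) c k | insertCode-↝ (ℤ.- z) c k
...   | z′ , k′ | p = ↝-trans ↝-swap (↝-∷ (decode c′) p)

sortCodes : (Fin 9 → ℕ) → Term 9 → ℤ × Key
sortCodes f (z , []) = z , []
sortCodes f (z , (a , b) ∷ es) with sortCodes f (z , es)
... | z′ , k = insertCode z′ (code (f a) (f b)) k

-- The images are tabulated so that all edges can share them, instead of evaluating the nested
-- insertions of `π` at every endpoint.
normalise : Permutation′ 9 → Term 9 → ℤ × Key
normalise π = sortCodes (lookup (tabulate (λ i → toℕ (π ⟨$⟩ʳ i))))

sortCodes-↝ : ∀ f (π : Permutation′ 9) → (∀ i → f i ≡ toℕ (π ⟨$⟩ʳ i)) →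
              ∀ z es → (z , relabelEdges π es) ↝ decodeAll (sortCodes f (z , es))
sortCodes-↝ f π f≗π z [] = ↝-refl
sortCodes-↝ f π f≗π z ((a , b) ∷ es) with sortCodes f (z , es) | sortCodes-↝ f π f≗π z es
... | z′ , k | p rewrite f≗π a | f≗π b =
  ↝-trans (↝-∷ _ p) (↝-trans (orient (decode-code (π ⟨$⟩ʳ a) (π ⟨$⟩ʳ b))) (insertCode-↝ z′ _ k))
  where
  orient : ∀ {z a b e} {es : Edges 9} → e ≡ (a , b) ⊎ e ≡ (b , a) → (z , (a , b) ∷ es) ↝ (z , e ∷ es)
  orient (inj₁ refl) = ↝-refl
  orient (inj₂ refl) = ↝-flip

normalise-⟶ : ∀ π t → t ⟶ decodeAll (normalise π t)
normalise-⟶ π (z , es) = ⟶-trans (⟶-relabel π z es)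
  (↝⇒⟶ [] (sortCodes-↝ _ π (lookup∘tabulate _) z es))

-- The terms of the differential

∈-concatMap-map⁻ : ∀ {A B C : Set} {f : A → B → C} {g : A → List B} {y} xs →
                   y ∈ concatMap (λ x → map (f x) (g x)) xs → ∃₂ λ x z → x ∈ xs × z ∈ g x × y ≡ f x z
∈-concatMap-map⁻ xs y∈ with find (∈-concatMap⁻ _ {xs = xs} y∈)
... | x , x∈ , y∈fx = let z , z∈ , y≡ = ∈-map⁻ _ y∈fx in x , z , x∈ , z∈ , y≡

∈-reattach-∷⁻ : ∀ n₁ m v a b es {r} → r ∈ reattach n₁ m v ((a , b) ∷ es) →
                ∃₂ λ a′ b′ → ∃ λ r′ → a′ ∈ endpoint n₁ m v a × b′ ∈ endpoint n₁ m v b ×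
                r′ ∈ reattach n₁ m v es × r ≡ (a′ , b′) ∷ r′
∈-reattach-∷⁻ n₁ m v a b es r∈ with find (∈-concatMap⁻ _ {xs = endpoint n₁ m v a} r∈)
... | a′ , a′∈ , r∈′ = let b′ , r′ , b′∈ , r′∈ , r≡ = ∈-concatMap-map⁻ (endpoint n₁ m v b) r∈′
                       in a′ , b′ , r′ , a′∈ , b′∈ , r′∈ , r≡

-- Contracts the inserted graph back to the vertex v that it replaced.
collapse : ∀ n₁ m → Fin (suc m) → Fin (n₁ ℕ.+ m) → Fin (suc m)
collapse n₁ m v w = [ (λ _ → v) , punchIn v ]′ (splitAt n₁ w)

collapseEdge : ∀ n₁ m → Fin (suc m) → Edge (n₁ ℕ.+ m) → Edge (suc m)
collapseEdge n₁ m v (a , b) = collapse n₁ m v a , collapse n₁ m v b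

collapse-↑ˡ : ∀ n₁ m v i → collapse n₁ m v (i ↑ˡ m) ≡ v
collapse-↑ˡ n₁ m v i rewrite Finₚ.splitAt-↑ˡ n₁ i m = refl

endpoint-collapse : ∀ n₁ m v a {a′} → a′ ∈ endpoint n₁ m v a → collapse n₁ m v a′ ≡ a
endpoint-collapse n₁ m v a a′∈ with v Finₚ.≟ a
... | yes refl with ∈-map⁻ (_↑ˡ m) a′∈
...   | i , _ , refl = collapse-↑ˡ n₁ m v i
endpoint-collapse n₁ m v a (here refl) | no v≢a
  rewrite Finₚ.splitAt-↑ʳ n₁ m (punchOut v≢a) = Finₚ.punchIn-punchOut v≢a

reattach-collapse : ∀ n₁ m v es {r} → r ∈ reattach n₁ m v es → map (collapseEdge n₁ m v) r ≡ es
reattach-collapse n₁ m v [] (here refl) = refl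
reattach-collapse n₁ m v ((a , b) ∷ es) r∈ with ∈-reattach-∷⁻ n₁ m v a b es r∈
... | a′ , b′ , r′ , a′∈ , b′∈ , r′∈ , refl = cong₂ _∷_
  (cong₂ _,_ (endpoint-collapse n₁ m v a a′∈) (endpoint-collapse n₁ m v b b′∈))
  (reattach-collapse n₁ m v es r′∈)

-- Edges created by the differential and triangles

Adjacent : Edges n → Fin n → Fin n → Set
Adjacent es a b = Any (SameEdge (a , b)) es

InTriangle : Edges n → Edge n → Set
InTriangle es (a , b) = ∃ λ w → Adjacent es a w × Adjacent es b w

SameEdge-trans : {e e′ e″ : Edge n} → SameEdge e e′ → SameEdge e′ e″ → SameEdge e e″
SameEdge-trans (inj₁ (refl , refl)) q = q
SameEdge-trans (inj₂ (refl , refl)) q = SameEdge-flipˡ q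

AllPairs-unique : ∀ {A : Set} {R : A → A → Set} → Symmetric R → ∀ {xs} → AllPairs (λ x y → ¬ R x y) xs →
                  ∀ {x y} → x ∈ xs → y ∈ xs → R x y → x ≡ y
AllPairs-unique R-sym (¬rs ∷ ps) (here refl) (here refl) r = refl
AllPairs-unique R-sym (¬rs ∷ ps) (here refl) (there y∈) r = contradiction r (All.lookup ¬rs y∈)
AllPairs-unique R-sym (¬rs ∷ ps) (there x∈) (here refl) r = contradiction (R-sym r) (All.lookup ¬rs x∈)
AllPairs-unique R-sym (¬rs ∷ ps) (there x∈) (there y∈) r = AllPairs-unique R-sym ps x∈ y∈ r

module Split {m} {es : Edges (suc m)} (simple : Simple (suc m , es)) (v : Fin (suc m)) {r : Edges (2 ℕ.+ m)}
             (r∈ : r ∈ reattach 2 m v es) where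

  private
    c : Edge (2 ℕ.+ m) → Edge (suc m)
    c = collapseEdge 2 m v

    contracted : map c r ≡ es
    contracted = reattach-collapse 2 m v es r∈

  c-loopless : All (λ e → proj₁ (c e) ≢ proj₂ (c e)) r
  c-loopless = Allₚ.map⁻ (subst (All _) (sym contracted) (proj₁ simple))

  c-distinct : AllPairs (λ e e′ → ¬ SameEdge (c e) (c e′)) r
  c-distinct = AllPairsₚ.map⁻ (subst (AllPairs _) (sym contracted) (proj₂ simple))

  SameEdge-c : ∀ {e e′} → SameEdge e e′ → SameEdge (c e) (c e′)
  SameEdge-c (inj₁ (refl , refl)) = inj₁ (refl , refl)
  SameEdge-c (inj₂ (refl , refl)) = inj₂ (refl , refl)

  -- The edges of `r` contract to those of the simple graph `es`. So they stay distinct and loopless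
  -- even after contraction, whereas the new edge contracts to a loop and thus differs from all of
  -- them.
  split-Simple : Simple (2 ℕ.+ m , (zero , suc zero) ∷ r)
  split-Simple =
    (λ ()) ∷ All.map (λ { ca≢cb refl → ca≢cb refl }) c-loopless ,
    All.map (λ { ca≢cb (inj₁ (refl , refl)) → ca≢cb refl ; ca≢cb (inj₂ (refl , refl)) → ca≢cb refl }) c-loopless ∷
    AllPairs.map (_∘ SameEdge-c) c-distinct

  r-loopless : ∀ {a} → ¬ Adjacent r a a
  r-loopless aa with find aa
  ... | _ , e∈ , inj₁ (refl , refl) = All.lookup c-loopless e∈ refl
  ... | _ , e∈ , inj₂ (refl , refl) = All.lookup c-loopless e∈ refl

  -- Edges from the two new vertices to a common neighbour would contract to the same edge of es.
  split-¬InTriangle : ¬ InTriangle ((zero , suc zero) ∷ r) (zero , suc zero)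
  split-¬InTriangle (_ , here (inj₁ (_ , refl)) , here (inj₁ (() , _)))
  split-¬InTriangle (_ , here (inj₁ (_ , refl)) , here (inj₂ (_ , ())))
  split-¬InTriangle (_ , here (inj₁ (_ , refl)) , there q) = r-loopless q
  split-¬InTriangle (_ , there p , here (inj₂ (_ , refl))) = r-loopless p
  split-¬InTriangle (w , there p , there q) with find p | find q
  ... | e , e∈ , 0w~e | f , f∈ , 1w~f
    with AllPairs-unique SameEdge-sym c-distinct e∈ f∈
           (SameEdge-trans (SameEdge-sym (SameEdge-c 0w~e)) (SameEdge-c 1w~f))
  ... | refl with SameEdge-trans 0w~e (SameEdge-sym 1w~f)
  ...   | inj₁ (() , _)
  ...   | inj₂ (refl , ())

liftEdge : ∀ m → Edge n → Edge (n ℕ.+ m)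
liftEdge m (a , b) = a ↑ˡ m , b ↑ˡ m

pendant : Edges n → Edge (n ℕ.+ 1) → Edges (n ℕ.+ 1)
pendant es e = map (liftEdge 1) es ++ [ e ]

module Pendant {n} {es : Edges n} (simple : Simple (n , es)) (i : Fin n) where

  private
    z : Fin (n ℕ.+ 1)
    z = n ↑ʳ zero

    ↑ˡ≢z : ∀ {j} → j ↑ˡ 1 ≢ z
    ↑ˡ≢z {j} eq with trans (sym (Finₚ.splitAt-↑ˡ n j 1)) (trans (cong (splitAt n) eq) (Finₚ.splitAt-↑ʳ n 1 zero))
    ... | ()

    ↑ˡ-injective : ∀ {j k} → j ↑ˡ 1 ≡ k ↑ˡ 1 → j ≡ k
    ↑ˡ-injective = Finₚ.↑ˡ-injective {n} 1 _ _

  IsPendant : Edge (n ℕ.+ 1) → Set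
  IsPendant e = SameEdge e (i ↑ˡ 1 , z)

  SameEdge-lift⁻ : ∀ {e f : Edge n} → SameEdge (liftEdge 1 e) (liftEdge 1 f) → SameEdge e f
  SameEdge-lift⁻ (inj₁ (p , q)) = inj₁ (↑ˡ-injective p , ↑ˡ-injective q)
  SameEdge-lift⁻ (inj₂ (p , q)) = inj₂ (↑ˡ-injective p , ↑ˡ-injective q)

  z∉lift : ∀ {w} f → ¬ SameEdge (z , w) (liftEdge 1 f)
  z∉lift f (inj₁ (p , _)) = ↑ˡ≢z (sym p)
  z∉lift f (inj₂ (p , _)) = ↑ˡ≢z (sym p)

  pendant-Simple : ∀ {e} → IsPendant e → Simple (n ℕ.+ 1 , pendant es e)
  pendant-Simple {e} e~ =
    Allₚ.++⁺ (Allₚ.map⁺ (All.map (_∘ ↑ˡ-injective) (proj₁ simple))) (e-loopless e~ ∷ []) ,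
    AllPairsₚ.++⁺ (AllPairsₚ.map⁺ (AllPairs.map (_∘ SameEdge-lift⁻) (proj₂ simple))) ([] ∷ [])
      (Allₚ.map⁺ (All.universal (λ f → (λ f~e → z∉lift f (SameEdge-sym (SameEdge-flipʳ (SameEdge-trans f~e e~)))) ∷ []) es))
    where
    e-loopless : ∀ {e} → IsPendant e → proj₁ e ≢ proj₂ e
    e-loopless (inj₁ (refl , refl)) = ↑ˡ≢z
    e-loopless (inj₂ (refl , refl)) = ↑ˡ≢z ∘ sym

  private
    z-neighbour : ∀ {e w} → IsPendant e → Adjacent (pendant es e) z w → w ≡ i ↑ˡ 1
    z-neighbour e~ zw with Anyₚ.++⁻ (map (liftEdge 1) es) zw
    ... | inj₁ zw′ = let f , _ , zw~f = find (Anyₚ.map⁻ zw′) in contradiction zw~f (z∉lift f)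
    ... | inj₂ (here zw~e) with SameEdge-trans zw~e e~
    ...   | inj₁ (p , _) = contradiction (sym p) ↑ˡ≢z
    ...   | inj₂ (_ , w≡) = w≡

    i-loopless : ∀ {e} → IsPendant e → ¬ Adjacent (pendant es e) (i ↑ˡ 1) (i ↑ˡ 1)
    i-loopless e~ ii with find ii
    ... | f , f∈ , ii~f = All.lookup (proj₁ (pendant-Simple e~)) f∈ (loop ii~f)
      where
      loop : ∀ {a} {f : Edge (n ℕ.+ 1)} → SameEdge (a , a) f → proj₁ f ≡ proj₂ f
      loop (inj₁ (refl , refl)) = refl
      loop (inj₂ (refl , refl)) = refl

  -- The new vertex `z` has `i` as its only neighbour, so a common neighbour of `z` and `i` would be
  -- `i` itself, with a loop there.
  pendant-¬InTriangle : ∀ {e} → IsPendant e → ¬ InTriangle (pendant es e) e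
  pendant-¬InTriangle e~@(inj₁ (refl , refl)) (w , iw , zw) with z-neighbour e~ zw
  ... | refl = i-loopless e~ iw
  pendant-¬InTriangle e~@(inj₂ (refl , refl)) (w , zw , iw) with z-neighbour e~ zw
  ... | refl = i-loopless e~ iw

open Pendant using (IsPendant)

ins-≡ : ∀ n es m es₂ → ins (n , es) (suc m , es₂) ≡
  concatMap (λ v → map (λ r → n ℕ.+ m , map (liftEdge m) es ++ r) (reattach n m v es₂)) (allFin (suc m))
ins-≡ n es m es₂ = concatMap-cong
  (λ v → map-cong (λ r → cong (λ es′ → n ℕ.+ m , es′ ++ r) (map-cong (λ _ → refl) es)) (reattach n m v es₂)) (allFin (suc m))

∈-ins-split : ∀ {m es G} → G ∈ ins dot-dot (suc m , es) →
              ∃₂ λ v r → r ∈ reattach 2 m v es × G ≡ (2 ℕ.+ m , (zero , suc zero) ∷ r)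
∈-ins-split {m} G∈ = let v , r , _ , r∈ , G≡ = ∈-concatMap-map⁻ (allFin (suc m)) G∈ in v , r , r∈ , G≡

-- Whichever end of the single edge is replaced, the other end survives as a new vertex of degree 1.
-- The choice only affects how the edge is oriented, which `SameEdge` absorbs.
∈-reattach-pendant : ∀ n v {r} → r ∈ reattach n 1 v (proj₂ dot-dot) →
                     ∃₂ λ i e → SameEdge e (i ↑ˡ 1 , n ↑ʳ zero) × r ≡ [ e ]
∈-reattach-pendant n zero r∈ with ∈-reattach-∷⁻ n 1 zero zero (suc zero) [] r∈
... | _ , _ , _ , a∈ , here refl , here refl , refl with ∈-map⁻ (_↑ˡ 1) a∈
...   | i , _ , refl = i , _ , inj₁ (refl , refl) , refl
∈-reattach-pendant n (suc zero) r∈ with ∈-reattach-∷⁻ n 1 (suc zero) zero (suc zero) [] r∈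
... | _ , _ , _ , here refl , b∈ , here refl , refl with ∈-map⁻ (_↑ˡ 1) b∈
...   | i , _ , refl = i , _ , inj₂ (refl , refl) , refl

∈-ins-pendant : ∀ {n es K} → K ∈ ins (n , es) dot-dot →
                ∃₂ λ i e → SameEdge e (i ↑ˡ 1 , n ↑ʳ zero) × K ≡ (n ℕ.+ 1 , pendant es e)
∈-ins-pendant {n} {es} {K} K∈
  with ∈-concatMap-map⁻ {f = λ _ r → n ℕ.+ 1 , map (liftEdge 1) es ++ r} {g = λ v → reattach n 1 v (proj₂ dot-dot)}
         (allFin 2) (subst (K ∈_) (ins-≡ n es 1 (proj₂ dot-dot)) K∈)
... | v , r , _ , r∈ , refl with ∈-reattach-pendant n v r∈
...   | i , e , e~ , refl = i , e , e~ , refl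

-- The cancellations in d γ₇

term : Term n → ℚ × LGraph
term (z , es) = ι z , (_ , es)

-- A search tree that carries no ordering invariant: like terms are merged only when their keys are
-- found to be equal, so a misplaced key could at worst leave them unmerged, and the final
-- evaluation would show it.
data Tree : Set where
  leaf : Tree
  node : Tree → Key → ℤ → Tree → Tree

data Comparison : Set where
  before same after : Comparison

compare : Key → Key → Comparison
compare [] [] = same
compare [] (_ ∷ _) = before
compare (_ ∷ _) [] = after
compare (c ∷ k) (c′ ∷ k′) = if c ≡ᵇ c′ then compare k k′ else if c <ᵇ c′ then before else after

compare-same : ∀ k k′ → compare k k′ ≡ same → k ≡ k′
compare-same [] [] _ = refl
compare-same (c ∷ k) (c′ ∷ k′) eq with c ≡ᵇ c′ in c≡ᵇc′
... | true = cong₂ _∷_ (ℕₚ.≡ᵇ⇒≡ c c′ (Equivalence.from T-≡ c≡ᵇc′)) (compare-same k k′ eq)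
... | false with c <ᵇ c′
compare-same (c ∷ k) (c′ ∷ k′) () | false | true
compare-same (c ∷ k) (c′ ∷ k′) () | false | false

add : ℤ × Key → Tree → Tree
add (z , k) leaf = node leaf k z leaf
add t@(z , k) (node l k′ z′ r) with compare k k′
... | before = node (add t l) k′ z′ r
... | same   = node l k′ (z ℤ.+ z′) r
... | after  = node l k′ z′ (add t r)

combo : Tree → Combo
combo leaf = []
combo (node l k z r) = combo l ++ term (decodeAll (z , k)) ∷ combo r

coeff-term-+ : ∀ z z′ k H → coeff ⟪ decodeAll (z ℤ.+ z′ , k) ⟫ H ≡
               coeff ⟪ decodeAll (z , k) ⟫ H + coeff ⟪ decodeAll (z′ , k) ⟫ H
coeff-term-+ z z′ k H = begin
  coeff ⟪ decodeAll (z ℤ.+ z′ , k) ⟫ H                   ≡⟨ coeff-∷ (ι (z ℤ.+ z′)) G [] H ⟩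
  ι (z ℤ.+ z′) * δ H G + 0ℚ                            ≡⟨ cong (λ q → q * δ H G + 0ℚ) (ι-+ z z′) ⟩
  (ι z + ι z′) * δ H G + 0ℚ
    ≡⟨ solve 3 (λ a b i → (a :+ b) :* i :+ con 0ℚ := (a :* i :+ con 0ℚ) :+ (b :* i :+ con 0ℚ))
       refl (ι z) (ι z′) (δ H G) ⟩
  (ι z * δ H G + 0ℚ) + (ι z′ * δ H G + 0ℚ)          ≡⟨ cong₂ _+_ (coeff-∷ (ι z) G [] H) (coeff-∷ (ι z′) G [] H) ⟨
  coeff ⟪ decodeAll (z , k) ⟫ H + coeff ⟪ decodeAll (z′ , k) ⟫ H ∎
  where
  open +-*-Solver
  G = 9 , map decode k

coeff-node : ∀ l k z r H → coeff (combo (node l k z r)) H ≡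
             coeff (combo l) H + (coeff ⟪ decodeAll (z , k) ⟫ H + coeff (combo r) H)
coeff-node l k z r H = trans (coeff-++ (combo l) _ H) (cong (coeff (combo l) H +_) (coeff-++ ⟪ decodeAll (z , k) ⟫ (combo r) H))

coeff-add : ∀ t T H → coeff (combo (add t T)) H ≡ coeff ⟪ decodeAll t ⟫ H + coeff (combo T) H
coeff-add t@(z , k) leaf H = sym (+-identityʳ _)
coeff-add t@(z , k) (node l k′ z′ r) H with compare k k′ in eq
... | before = begin
  coeff (combo (node (add t l) k′ z′ r)) H                     ≡⟨ coeff-node (add t l) k′ z′ r H ⟩
  coeff (combo (add t l)) H + (x + b)                        ≡⟨ cong ( _+ (x + b)) (coeff-add t l H) ⟩
  (c + a) + (x + b)
    ≡⟨ solve 4 (λ a b c x → (c :+ a) :+ (x :+ b) := c :+ (a :+ (x :+ b))) refl a b c x ⟩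
  c + (a + (x + b))                                         ≡⟨ cong (c +_) (coeff-node l k′ z′ r H) ⟨
  c + coeff (combo (node l k′ z′ r)) H                        ∎
  where
  open +-*-Solver
  a = coeff (combo l) H
  b = coeff (combo r) H
  c = coeff ⟪ decodeAll t ⟫ H
  x = coeff ⟪ decodeAll (z′ , k′) ⟫ H
... | after = begin
  coeff (combo (node l k′ z′ (add t r))) H                     ≡⟨ coeff-node l k′ z′ (add t r) H ⟩
  a + (x + coeff (combo (add t r)) H)                        ≡⟨ cong (λ y → a + (x + y)) (coeff-add t r H) ⟩
  a + (x + (c + b))
    ≡⟨ solve 4 (λ a b c x → a :+ (x :+ (c :+ b)) := c :+ (a :+ (x :+ b))) refl a b c x ⟩
  c + (a + (x + b))                                         ≡⟨ cong (c +_) (coeff-node l k′ z′ r H) ⟨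
  c + coeff (combo (node l k′ z′ r)) H                        ∎
  where
  open +-*-Solver
  a = coeff (combo l) H
  b = coeff (combo r) H
  c = coeff ⟪ decodeAll t ⟫ H
  x = coeff ⟪ decodeAll (z′ , k′) ⟫ H
... | same with compare-same k k′ eq
...   | refl = begin
  coeff (combo (node l k (z ℤ.+ z′) r)) H                      ≡⟨ coeff-node l k (z ℤ.+ z′) r H ⟩
  a + (coeff ⟪ decodeAll (z ℤ.+ z′ , k) ⟫ H + b)             ≡⟨ cong (λ y → a + (y + b)) (coeff-term-+ z z′ k H) ⟩
  a + ((c + x) + b)
    ≡⟨ solve 4 (λ a b c x → a :+ ((c :+ x) :+ b) := c :+ (a :+ (x :+ b))) refl a b c x ⟩
  c + (a + (x + b))                                         ≡⟨ cong (c +_) (coeff-node l k z′ r H) ⟨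
  c + coeff (combo (node l k z′ r)) H                         ∎
  where
  open +-*-Solver
  a = coeff (combo l) H
  b = coeff (combo r) H
  c = coeff ⟪ decodeAll t ⟫ H
  x = coeff ⟪ decodeAll (z′ , k) ⟫ H

add-≈ : ∀ t T {x y} → x ≈ ⟪ decodeAll t ⟫ → y ≈ combo T → x ++ y ≈ combo (add t T)
add-≈ t T {x} {y} x≈ y≈ = ≈-trans {x ++ y} {⟪ decodeAll t ⟫ ++ combo T} {combo (add t T)}
  (≈-++ {x} {⟪ decodeAll t ⟫} {y} {combo T} x≈ y≈)
  (≐⇒≈ (⟪ decodeAll t ⟫ ++ combo T) (combo (add t T)) λ H → trans (coeff-++ ⟪ decodeAll t ⟫ (combo T) H)
    (sym (coeff-add t T H)))

SimpleKey : Key → Set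
SimpleKey k = Simple (9 , map decode k)

AllKeys : (Key → Set) → Tree → Set
AllKeys P leaf = ⊤
AllKeys P (node l k _ r) = AllKeys P l × P k × AllKeys P r

add-AllKeys : ∀ {P : Key → Set} t T → P (proj₂ t) → AllKeys P T → AllKeys P (add t T)
add-AllKeys t leaf p _ = tt , p , tt
add-AllKeys t@(_ , k) (node l k′ _ r) p (pl , p′ , pr) with compare k k′
... | before = add-AllKeys t l p pl , p′ , pr
... | same   = pl , p′ , pr
... | after  = pl , p′ , add-AllKeys t r p pr

entry : ℤ → Key → List (ℤ × Key)
entry (ℤ.+ 0) k = []
entry z k = [ z , k ]

entries : Tree → List (ℤ × Key)
entries leaf = []
entries (node l k z r) = entries l ++ entry z k ++ entries r

sumKeys : List (ℤ × Key) → Combo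
sumKeys = map (term ∘ decodeAll)

coeff-entry : ∀ z k H → coeff ⟪ decodeAll (z , k) ⟫ H ≡ coeff (sumKeys (entry z k)) H
coeff-entry (ℤ.+ 0) k H = trans (coeff-∷ (ι 0ℤ) G [] H) (trans (cong (λ q → q * δ H G + 0ℚ) ι-0)
  (solve 1 (λ i → con 0ℚ :* i :+ con 0ℚ := con 0ℚ) refl (δ H G)))
  where
  open +-*-Solver
  G = 9 , map decode k
coeff-entry (ℤ.+ (suc _)) k H = refl
coeff-entry (ℤ.-[1+ _ ]) k H = refl

coeff-entries : ∀ T H → coeff (combo T) H ≡ coeff (sumKeys (entries T)) H
coeff-entries leaf H = refl
coeff-entries (node l k z r) H = begin
  coeff (combo (node l k z r)) H
    ≡⟨ coeff-node l k z r H ⟩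
  coeff (combo l) H + (coeff ⟪ decodeAll (z , k) ⟫ H + coeff (combo r) H)
    ≡⟨ cong₂ _+_ (coeff-entries l H) (cong₂ _+_ (coeff-entry z k H) (coeff-entries r H)) ⟩
  coeff (sumKeys (entries l)) H + (coeff (sumKeys (entry z k)) H + coeff (sumKeys (entries r)) H)
    ≡⟨ cong (coeff (sumKeys (entries l)) H +_) (coeff-++ (sumKeys (entry z k)) _ H) ⟨
  coeff (sumKeys (entries l)) H + coeff (sumKeys (entry z k) ++ sumKeys (entries r)) H
    ≡⟨ cong (λ x → coeff (sumKeys (entries l)) H + coeff x H) (map-++ (term ∘ decodeAll) (entry z k) (entries r)) ⟨
  coeff (sumKeys (entries l)) H + coeff (sumKeys (entry z k ++ entries r)) H
    ≡⟨ coeff-++ (sumKeys (entries l)) _ H ⟨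
  coeff (sumKeys (entries l) ++ sumKeys (entry z k ++ entries r)) H
    ≡⟨ cong (λ x → coeff x H) (map-++ (term ∘ decodeAll) (entries l) (entry z k ++ entries r)) ⟨
  coeff (sumKeys (entries (node l k z r))) H ∎

entry-All : ∀ {P : Key → Set} z {k} → P k → All (P ∘ proj₂) (entry z k)
entry-All (ℤ.+ 0) p = []
entry-All (ℤ.+ (suc _)) p = p ∷ []
entry-All (ℤ.-[1+ _ ]) p = p ∷ []

entries-All : ∀ {P : Key → Set} T → AllKeys P T → All (P ∘ proj₂) (entries T)
entries-All leaf _ = []
entries-All (node l k z r) (pl , p , pr) = Allₚ.++⁺ (entries-All l pl) (Allₚ.++⁺ (entry-All z p) (entries-All r pr))

-- The tag is the relabelling for the first normal form. It is fixed when the term is generated,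
-- because it depends on the vertex that was split, which the term itself no longer shows.
Tagged : Set
Tagged = Permutation′ 9 × Term 9

untag : Tagged → ℚ × LGraph
untag (_ , t) = term t

collect : List Tagged → Tree
collect [] = leaf
collect ((π , t) ∷ ts) = add (normalise π t) (collect ts)

SimpleTerm : Term n → Set
SimpleTerm (_ , es) = Simple (_ , es)

-- Simplicity of the collected keys is recorded because `canonise` applies further relations to
-- them.
collect-≈ : ∀ {ts} → All (SimpleTerm ∘ proj₂) ts → map untag ts ≈ combo (collect ts) × AllKeys SimpleKey (collect ts)
collect-≈ {[]} [] = ≈-refl {[]} , tt
collect-≈ {(π , t) ∷ ts} (s ∷ ss) =
  let s′ , t≈ = _⟶_.apply (normalise-⟶ π t) s
      ts≈ , keys = collect-≈ ss
  in add-≈ (normalise π t) (collect ts) {⟪ t ⟫} {map untag ts} t≈ ts≈ , add-AllKeys (normalise π t) (collect ts) s′ keys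

-- Each mixed-radix digit of r selects an image among those that are left, so that every number encodes a permutation.
lehmer : ∀ n → ℕ → Permutation′ n
lehmer zero _ = id
lehmer (suc n) r = insert zero (r mod suc n) (lehmer n (r ℕ./ suc n))

_≟K_ : (t t′ : ℤ × Key) → Dec (t ≡ t′)
_≟K_ = ×ₚ.≡-dec ℤ._≟_ (Listₚ.≡-dec ℕ._≟_)

-- If t′ = - t represents the same element as t, this element is zero and t is dropped.
absorb : ℤ × Key → ℤ × Key → Tree → Tree
absorb t@(z , k) t′ T with t′ ≟K (ℤ.- z , k)
... | yes _ = T
... | no _ = add t′ T

absorb-≈ : ∀ t t′ T {y} → ⟪ decodeAll t ⟫ ≈ ⟪ decodeAll t′ ⟫ → y ≈ combo T →
           ⟪ decodeAll t ⟫ ++ y ≈ combo (absorb t t′ T)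
absorb-≈ t@(z , k) t′ T {y} t≈ y≈ with t′ ≟K (ℤ.- z , k)
... | yes refl = ≈-++ {⟪ decodeAll t ⟫} {[]} {y} {combo T}
  (≈-neg⇒≈[] (ι z) (9 , map decode k) (subst (λ q → ⟪ decodeAll t ⟫ ≈ [ q , (9 , map decode k) ]) (ι-neg z) t≈)) y≈
... | no _ = add-≈ t′ T {⟪ decodeAll t ⟫} {y} t≈ y≈

canonise : List (Permutation′ 9) → List (ℤ × Key) → Tree
canonise _ [] = leaf
canonise [] (t ∷ ts) = add t (canonise [] ts)
canonise (π ∷ πs) (t ∷ ts) = absorb t (normalise π (decodeAll t)) (canonise πs ts)

canonise-≈ : ∀ πs {ts} → All (SimpleKey ∘ proj₂) ts → sumKeys ts ≈ combo (canonise πs ts)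
canonise-≈ _ [] = ≈-refl {[]}
canonise-≈ [] {t ∷ ts} (s ∷ ss) =
  add-≈ t (canonise [] ts) {⟪ decodeAll t ⟫} {sumKeys ts} (≈-refl {⟪ decodeAll t ⟫}) (canonise-≈ [] ss)
canonise-≈ (π ∷ πs) {t ∷ ts} (s ∷ ss) = absorb-≈ t (normalise π (decodeAll t)) (canonise πs ts) {sumKeys ts}
  (proj₂ (_⟶_.apply (normalise-⟶ π (decodeAll t)) s)) (canonise-≈ πs ss)

-- For a simple graph this is 512 times the degree plus the set of neighbours as a bit mask; labels
-- are at most 8, so the mask stays below 512 and only breaks ties. The halves of a split vertex
-- have no common neighbour, so their weights differ unless both are zero, and the heavier half does
-- not depend on the order of the two.
weight : Fin 9 → Edges 9 → ℕ
weight u [] = 0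
weight u ((a , b) ∷ es) =
  (if does (u Finₚ.≟ a) then 512 ℕ.+ 2 ℕ.^ toℕ b else if does (u Finₚ.≟ b) then 512 ℕ.+ 2 ℕ.^ toℕ a else 0) ℕ.+ weight u es

-- The heavier half of the split vertex v keeps the label v and the other one becomes the last vertex.
-- This makes the terms with a vertex of degree 1 or 2 cancel pairwise without further relabelling.
unsplit : Fin 8 → Edges 9 → Permutation′ 9
unsplit v r = insert (if weight zero r <ᵇ weight (suc zero) r then suc zero else zero) (inject₁ v) (insert zero (fromℕ 7) id)

splitTerms : Term 8 → List Tagged
splitTerms (z , es) = concatMap (λ v → map (λ r → unsplit v r , z , (zero , suc zero) ∷ r) (reattach 2 7 v es)) (allFin 8)

pendantCoeff : ℕ → ℤ → ℤ
pendantCoeff zero z = ℤ.- z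
pendantCoeff (suc m) z = ℤ.- pendantCoeff m z

pendantTerms : Term 8 → List Tagged
pendantTerms (z , es) = concatMap
  (λ v → map (λ r → id , pendantCoeff (length es) z , map (liftEdge 1) es ++ r) (reattach 8 1 v (proj₂ dot-dot))) (allFin 2)

dTerms : List (Term 8) → List Tagged
dTerms = concatMap λ t → splitTerms t ++ pendantTerms t

map-concatMap-map : ∀ {A B C D : Set} (f : C → D) (g : A → B → C) (h : A → List B) xs →
                    map f (concatMap (λ x → map (g x) (h x)) xs) ≡ concatMap (λ x → map (f ∘ g x) (h x)) xs
map-concatMap-map f g h xs = trans (map-concatMap f (λ x → map (g x) (h x)) xs) (concatMap-cong (λ x → sym (map-∘ (h x))) xs)

splitTerms-≡ : ∀ z es → map untag (splitTerms (z , es)) ≡ map (λ G → 1ℚ * ι z , G) (ins dot-dot (8 , es))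
splitTerms-≡ z es = begin
  map untag (splitTerms (z , es))
    ≡⟨ map-concatMap-map untag (λ v r → unsplit v r , z , (zero , suc zero) ∷ r) (λ v → reattach 2 7 v es) (allFin 8) ⟩
  concatMap (λ v → map (λ r → ι z , (9 , (zero , suc zero) ∷ r)) (reattach 2 7 v es)) (allFin 8)
    ≡⟨ concatMap-cong (λ v → map-cong (λ r → cong (_, (9 , (zero , suc zero) ∷ r)) (sym (*-identityˡ (ι z))))
         (reattach 2 7 v es)) (allFin 8) ⟩
  concatMap (λ v → map (λ r → 1ℚ * ι z , (9 , (zero , suc zero) ∷ r)) (reattach 2 7 v es)) (allFin 8)
    ≡⟨ map-concatMap-map (λ G → 1ℚ * ι z , G) (λ v r → 9 , (zero , suc zero) ∷ r) (λ v → reattach 2 7 v es) (allFin 8) ⟨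
  map (λ G → 1ℚ * ι z , G) (ins dot-dot (8 , es)) ∎

pendantCoeff-≡ : ∀ m z → ι (pendantCoeff m z) ≡ - negPow m * (1ℚ * ι z)
pendantCoeff-≡ zero z = trans (ι-neg z) (solve 1 (λ a → :- a := (:- con 1ℚ) :* (con 1ℚ :* a)) refl (ι z))
  where open +-*-Solver
pendantCoeff-≡ (suc m) z = trans (ι-neg (pendantCoeff m z)) (trans (cong -_ (pendantCoeff-≡ m z))
  (solve 2 (λ p a → :- ((:- p) :* (con 1ℚ :* a)) := (:- (:- p)) :* (con 1ℚ :* a)) refl (negPow m) (ι z)))
  where open +-*-Solver

pendantTerms-≡ : ∀ z es → map untag (pendantTerms (z , es)) ≡
                 map (λ G → - negPow (1 ℕ.* length es) * (1ℚ * ι z) , G) (ins (8 , es) dot-dot)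
pendantTerms-≡ z es = begin
  map untag (pendantTerms (z , es))
    ≡⟨ map-concatMap-map untag (λ v r → id , pendantCoeff (length es) z , map (liftEdge 1) es ++ r) r₁ (allFin 2) ⟩
  concatMap (λ v → map (λ r → ι (pendantCoeff (length es) z) , (9 , map (liftEdge 1) es ++ r)) (r₁ v)) (allFin 2)
    ≡⟨ concatMap-cong (λ v → map-cong (λ r → cong (_, (9 , map (liftEdge 1) es ++ r)) q≡) (r₁ v)) (allFin 2) ⟩
  concatMap (λ v → map (λ r → q , (9 , map (liftEdge 1) es ++ r)) (r₁ v)) (allFin 2)
    ≡⟨ map-concatMap-map (λ G → q , G) (λ v r → 9 , map (liftEdge 1) es ++ r) r₁ (allFin 2) ⟨
  map (λ G → q , G) (concatMap (λ v → map (λ r → 9 , map (liftEdge 1) es ++ r) (r₁ v)) (allFin 2))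
    ≡⟨ cong (map (λ G → q , G)) (ins-≡ 8 es 1 (proj₂ dot-dot)) ⟨
  map (λ G → q , G) (ins (8 , es) dot-dot) ∎
  where
  r₁ : Fin 2 → List (Edges 9)
  r₁ v = reattach 8 1 v (proj₂ dot-dot)
  q = - negPow (1 ℕ.* length es) * (1ℚ * ι z)
  q≡ : ι (pendantCoeff (length es) z) ≡ q
  q≡ = trans (pendantCoeff-≡ (length es) z) (cong (λ m → - negPow m * (1ℚ * ι z)) (sym (ℕₚ.*-identityˡ (length es))))

d-dTerms : ∀ ts → d (map term ts) ≡ map untag (dTerms ts)
d-dTerms ts = trans (++-identityʳ _) (go ts (λ _ _ → refl))
  where
  -- `f` stands for the anonymous function inside `bracket`, of which only the values on terms
  -- matter.
  go : ∀ {f} ts → (∀ z es → f (term (z , es)) ≡ map (λ G → 1ℚ * ι z , G) (ins dot-dot (8 , es))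
                     ++ map (λ G → - negPow (1 ℕ.* length es) * (1ℚ * ι z) , G) (ins (8 , es) dot-dot)) →
       concatMap f (map term ts) ≡ map untag (dTerms ts)
  go [] _ = refl
  go (t@(z , es) ∷ ts) f≗ = begin
    _ ≡⟨ cong₂ _++_ (f≗ z es) (go ts f≗) ⟩
    (map (λ G → 1ℚ * ι z , G) (ins dot-dot (8 , es))
      ++ map (λ G → - negPow (1 ℕ.* length es) * (1ℚ * ι z) , G) (ins (8 , es) dot-dot))
      ++ map untag (dTerms ts)
      ≡⟨ cong₂ (λ x y → (x ++ y) ++ map untag (dTerms ts)) (splitTerms-≡ z es) (pendantTerms-≡ z es) ⟨
    (map untag (splitTerms t) ++ map untag (pendantTerms t)) ++ map untag (dTerms ts)
      ≡⟨ cong (_++ map untag (dTerms ts)) (map-++ untag (splitTerms t) (pendantTerms t)) ⟨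
    map untag (splitTerms t ++ pendantTerms t) ++ map untag (dTerms ts)
      ≡⟨ map-++ untag (splitTerms t ++ pendantTerms t) (dTerms ts) ⟨
    map untag (dTerms (t ∷ ts)) ∎

All-concatMap-map : ∀ {A B C : Set} {P : C → Set} (f : A → B → C) (g : A → List B) xs →
                    (∀ x {y} → y ∈ g x → P (f x y)) → All P (concatMap (λ x → map (f x) (g x)) xs)
All-concatMap-map f g xs p = Allₚ.concat⁺ (Allₚ.map⁺ (All.universal (λ x → Allₚ.map⁺ (All.tabulate (p x))) xs))

dTerms-Simple : ∀ {ts} → All SimpleTerm ts → All (SimpleTerm ∘ proj₂) (dTerms ts)
dTerms-Simple ss = Allₚ.concat⁺ (Allₚ.map⁺ (All.map (λ {t} s → Allₚ.++⁺ (splits t s) (pendants t s)) ss))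
  where
  splits : ∀ t → SimpleTerm t → All (SimpleTerm ∘ proj₂) (splitTerms t)
  splits (z , es) s = All-concatMap-map (λ v r → unsplit v r , z , (zero , suc zero) ∷ r) (λ v → reattach 2 7 v es) (allFin 8)
    (Split.split-Simple s)
  pendants : ∀ t → SimpleTerm t → All (SimpleTerm ∘ proj₂) (pendantTerms t)
  pendants (z , es) s = All-concatMap-map (λ v r → id , pendantCoeff (length es) z , map (liftEdge 1) es ++ r)
    (λ v → reattach 8 1 v (proj₂ dot-dot)) (allFin 2) simple
    where
    simple : ∀ v {r} → r ∈ reattach 8 1 v (proj₂ dot-dot) → Simple (9 , map (liftEdge 1) es ++ r)
    simple v r∈ with ∈-reattach-pendant 8 v r∈
    ... | i , e , e~ , refl = Pendant.pendant-Simple s i e~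

-- Terms and permutations are arbitrary here. A wrong permutation would still yield a valid chain of
-- relations and would merely make `empty` fail, so this equation is all that has to be evaluated
-- for `γ₇`.
cocycle : ∀ πs ts → All SimpleTerm ts → entries (canonise πs (entries (collect (dTerms ts)))) ≡ [] →
          IsZero (d (map term ts))
cocycle πs ts ss empty = ≈[]⇒IsZero {d (map term ts)} (subst (_≈ []) (sym (d-dTerms ts))
  (≈-trans {map untag (dTerms ts)} {combo T} {[]} collected
  (≈-trans {combo T} {sumKeys (entries T)} {[]} (≐⇒≈ (combo T) (sumKeys (entries T)) (coeff-entries T))
  (≈-trans {sumKeys (entries T)} {combo T′} {[]} (canonise-≈ πs (entries-All T keys))
  (≐⇒≈ (combo T′) [] λ H → trans (coeff-entries T′ H) (cong (λ ks → coeff (sumKeys ks) H) empty))))))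
  where
  T = collect (dTerms ts)
  T′ = canonise πs (entries T)
  collected = proj₁ (collect-≈ (dTerms-Simple ss))
  keys = proj₂ (collect-≈ (dTerms-Simple ss))

simple? : ∀ G → Dec (Simple G)
simple? (n , es) = All.all? (λ { (a , b) → ¬? (a Finₚ.≟ b) }) es ×-dec allPairs? (λ e e′ → ¬? (sameEdge? e e′)) es

-- The numerator of `16 q` is the whole number because 16 is a common denominator, and the fallback
-- clause is never reached; `γ₇-≡` confirms both.
γ₇-terms : List (Term 8)
γ₇-terms = map (λ { (q , (8 , es)) → ↥ (q * (ℤ.+ 16 / 1)) , es ; _ → 0ℤ , [] }) γ₇

opaque
  unfolding ι

  γ₇-≡ : γ₇ ≡ map term γ₇-terms
  γ₇-≡ = refl

γ₇-Simple : All SimpleTerm γ₇-terms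
γ₇-Simple = from-yes (All.all? (λ t → simple? (8 , proj₂ t)) γ₇-terms)

-- One permutation for each surviving key, in the order of the keys: it leads to the canonical representative of the
-- isomorphism class, or is an odd automorphism.
certificate : List ℕ
certificate =
  269136 ∷ 350784 ∷ 335664 ∷ 279235 ∷ 263610 ∷ 60489 ∷ 335664 ∷ 350784 ∷ 263610 ∷ 3024 ∷ 279235 ∷ 21168 ∷ 290809 ∷
  320544 ∷ 290809 ∷ 353305 ∷ 160794 ∷ 217890 ∷ 278370 ∷ 278370 ∷ 275409 ∷ 342234 ∷ 342234 ∷ 312489 ∷ 312489 ∷
  331226 ∷ 275409 ∷ 275939 ∷ 269136 ∷ 272241 ∷ 257130 ∷ 278946 ∷ 263772 ∷ 275202 ∷ 260082 ∷ 260595 ∷ 263772 ∷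
  263773 ∷ 275256 ∷ 260136 ∷ 275832 ∷ 260577 ∷ 278946 ∷ 278947 ∷ 160427 ∷ 218377 ∷ 341868 ∷ 338844 ∷ 248481 ∷
  264665 ∷ 324174 ∷ 91368 ∷ 333144 ∷ 273978 ∷ 258723 ∷ 347832 ∷ 332712 ∷ 273978 ∷ 276426 ∷ 348264 ∷ 318537 ∷ 336168 ∷
  258723 ∷ 261747 ∷ 281881 ∷ 278857 ∷ 262584 ∷ 352225 ∷ 290521 ∷ 321552 ∷ 172980 ∷ 80640 ∷ 355103 ∷ 221906 ∷ 264105 ∷
  351539 ∷ 158329 ∷ 218774 ∷ 267389 ∷ 279254 ∷ 278822 ∷ 321299 ∷ 282386 ∷ 282467 ∷ 339769 ∷ 339769 ∷ 264096 ∷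
  264189 ∷ 267275 ∷ 263819 ∷ 250704 ∷ 254628 ∷ 303408 ∷ 325224 ∷ 242937 ∷ 264627 ∷ 305424 ∷ 324720 ∷ 321624 ∷
  244953 ∷ 264123 ∷ 260586 ∷ 262584 ∷ 264124 ∷ 261091 ∷ 263620 ∷ 269136 ∷ 325225 ∷ 322201 ∷ 321121 ∷ 262584 ∷
  355103 ∷ 354484 ∷ 252146 ∷ 218763 ∷ 291414 ∷ 267266 ∷ 263819 ∷ 276348 ∷ 276286 ∷ 269136 ∷ 272233 ∷ 320617 ∷
  278950 ∷ 263884 ∷ 290817 ∷ 320544 ∷ 275698 ∷ 278951 ∷ 278879 ∷ 248133 ∷ 287793 ∷ 245778 ∷ 15120 ∷ 266504 ∷ 266514 ∷
  269136 ∷ 248512 ∷ 257584 ∷ 305497 ∷ 263162 ∷ 248188 ∷ 257260 ∷ 245017 ∷ 260657 ∷ 245017 ∷ 241993 ∷ 263884 ∷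
  263811 ∷ 236909 ∷ 330893 ∷ 258276 ∷ 79488 ∷ 297389 ∷ 297470 ∷ 332649 ∷ 288361 ∷ 333144 ∷ 21168 ∷ 347769 ∷ 320563 ∷
  275939 ∷ 332649 ∷ 320185 ∷ 318528 ∷ 249188 ∷ 290313 ∷ 359876 ∷ 258276 ∷ 219183 ∷ 4032 ∷ 263613 ∷ 264621 ∷ 261093 ∷
  263614 ∷ 179586 ∷ 300662 ∷ 330443 ∷ 324605 ∷ 324686 ∷ 261247 ∷ 276771 ∷ 276772 ∷ 279291 ∷ 275763 ∷ 294482 ∷
  294563 ∷ 324804 ∷ 324803 ∷ 237036 ∷ 312636 ∷ 273279 ∷ 179523 ∷ 261183 ∷ 504 ∷ 297516 ∷ 297587 ∷ 261300 ∷ 504 ∷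
  261238 ∷ 327756 ∷ 327827 ∷ 261165 ∷ 261000 ∷ 321120 ∷ 260640 ∷ 275706 ∷ 276282 ∷ 261162 ∷ 263169 ∷ 248202 ∷
  261000 ∷ 245016 ∷ 260091 ∷ 244944 ∷ 241920 ∷ 263233 ∷ 245017 ∷ 241993 ∷ 241920 ∷ 279243 ∷ 279306 ∷ 360891 ∷
  360964 ∷ 291312 ∷ 321057 ∷ 291384 ∷ 321066 ∷ 290808 ∷ 321561 ∷ 321183 ∷ 351720 ∷ 345915 ∷ 80640 ∷ 321651 ∷ 345843 ∷
  345834 ∷ 321652 ∷ 291411 ∷ 291412 ∷ 160761 ∷ 218809 ∷ 341875 ∷ 338851 ∷ 4043 ∷ 311717 ∷ 324174 ∷ 348408 ∷ 288009 ∷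
  258507 ∷ 276984 ∷ 287496 ∷ 317745 ∷ 272898 ∷ 263736 ∷ 287784 ∷ 317520 ∷ 273240 ∷ 288432 ∷ 260145 ∷ 263736 ∷
  260721 ∷ 283337 ∷ 280313 ∷ 276913 ∷ 280313 ∷ 157473 ∷ 221762 ∷ 342210 ∷ 338923 ∷ 333362 ∷ 282252 ∷ 283346 ∷
  252072 ∷ 336385 ∷ 321194 ∷ 269136 ∷ 272160 ∷ 257113 ∷ 260514 ∷ 260217 ∷ 260289 ∷ 264314 ∷ 275690 ∷ 262595 ∷
  276194 ∷ 260065 ∷ 279369 ∷ 305516 ∷ 245016 ∷ 302421 ∷ 321171 ∷ 241921 ∷ 260641 ∷ 287280 ∷ 323752 ∷ 320727 ∷
  269136 ∷ 324104 ∷ 321089 ∷ 320575 ∷ 260065 ∷ 263665 ∷ 261146 ∷ 264314 ∷ 263810 ∷ 335736 ∷ 219597 ∷ 335736 ∷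
  335817 ∷ 278940 ∷ 21168 ∷ 335665 ∷ 321564 ∷ 321050 ∷ 264748 ∷ 158742 ∷ 220335 ∷ 248988 ∷ 258060 ∷ 308601 ∷ 244946 ∷
  302481 ∷ 323884 ∷ 257546 ∷ 261589 ∷ 287280 ∷ 323813 ∷ 261260 ∷ 305433 ∷ 254250 ∷ 287795 ∷ 321571 ∷ 241994 ∷
  263316 ∷ 287280 ∷ 263326 ∷ 260301 ∷ 249188 ∷ 263695 ∷ 269136 ∷ 324596 ∷ 321581 ∷ 269136 ∷ 249188 ∷ 261094 ∷
  350856 ∷ 279867 ∷ 335817 ∷ 335827 ∷ 264335 ∷ 258259 ∷ 350785 ∷ 336180 ∷ 320717 ∷ 260671 ∷ 264263 ∷ 264263 ∷
  347761 ∷ 273713 ∷ 258656 ∷ 350785 ∷ 335736 ∷ 258666 ∷ 261257 ∷ 269136 ∷ 276727 ∷ 269136 ∷ 290305 ∷ 320545 ∷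
  278896 ∷ 263776 ∷ 335665 ∷ 278526 ∷ 278525 ∷ 21168 ∷ 4043 ∷ 336169 ∷ 336170 ∷ 278825 ∷ 278825 ∷ 263705 ∷ 263705 ∷
  264352 ∷ 263848 ∷ 281810 ∷ 278786 ∷ 60995 ∷ 336169 ∷ 260066 ∷ 264171 ∷ 261000 ∷ 260657 ∷ 263162 ∷ 263739 ∷ 260715 ∷
  263235 ∷ 260571 ∷ 290881 ∷ 321121 ∷ 261161 ∷ 276120 ∷ 261161 ∷ 279362 ∷ 21168 ∷ 264757 ∷ 336243 ∷ 264757 ∷ 248142 ∷
  257204 ∷ 245714 ∷ 281507 ∷ 266305 ∷ 6590 ∷ 287280 ∷ 248512 ∷ 257080 ∷ 184555 ∷ 269136 ∷ 264689 ∷ 257764 ∷ 181522 ∷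
  263101 ∷ 245035 ∷ 242011 ∷ 267201 ∷ 263673 ∷ 262584 ∷ 336312 ∷ 336330 ∷ 321120 ∷ 279369 ∷ 279297 ∷ 342369 ∷
  339345 ∷ 276264 ∷ 323649 ∷ 262584 ∷ 321282 ∷ 323730 ∷ 320553 ∷ 324162 ∷ 321138 ∷ 263160 ∷ 263817 ∷ 260712 ∷
  321066 ∷ 351432 ∷ 336321 ∷ 353304 ∷ 336249 ∷ 261163 ∷ 351288 ∷ 262584 ∷ 336330 ∷ 290952 ∷ 321192 ∷ 261351 ∷
  351432 ∷ 336312 ∷ 260703 ∷ 351361 ∷ 260641 ∷ 260641 ∷ 336241 ∷ 260145 ∷ 248211 ∷ 260703 ∷ 305517 ∷ 263115 ∷
  245035 ∷ 242011 ∷ 260208 ∷ 245025 ∷ 242001 ∷ 242001 ∷ 346000 ∷ 355001 ∷ 225022 ∷ 234084 ∷ 345928 ∷ 355001 ∷ 80640 ∷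
  339808 ∷ 327782 ∷ 267374 ∷ 282468 ∷ 294564 ∷ 294565 ∷ 19656 ∷ 234094 ∷ 164470 ∷ 327782 ∷ 276446 ∷ 79184 ∷ 345901 ∷
  603 ∷ 336837 ∷ 18336 ∷ 294565 ∷ 173560 ∷ 234091 ∷ 173632 ∷ 339305 ∷ 309612 ∷ 264252 ∷ 324661 ∷ 261237 ∷ 347761 ∷
  276737 ∷ 258735 ∷ 350786 ∷ 335666 ∷ 261195 ∷ 261256 ∷ 276728 ∷ 276799 ∷ 60995 ∷ 336169 ∷ 351363 ∷ 351792 ∷ 336672 ∷
  336321 ∷ 351865 ∷ 279451 ∷ 294076 ∷ 327854 ∷ 267364 ∷ 70232 ∷ 264268 ∷ 324830 ∷ 70232 ∷ 164549 ∷ 173621 ∷ 224950 ∷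
  234022 ∷ 327854 ∷ 267302 ∷ 276359 ∷ 336911 ∷ 282396 ∷ 294493 ∷ 34056 ∷ 282325 ∷ 276625 ∷ 279033 ∷ 260094 ∷ 321088 ∷
  264361 ∷ 290954 ∷ 261290 ∷ 321142 ∷ 276431 ∷ 336910 ∷ 174 ∷ 336839 ∷ 279033 ∷ 16321 ∷ 345988 ∷ 339931 ∷ 101808 ∷
  339436 ∷ 276356 ∷ 321715 ∷ 60552 ∷ 321714 ∷ 321149 ∷ 15718 ∷ 261254 ∷ 321255 ∷ 276347 ∷ 321706 ∷ 258285 ∷ 261237 ∷
  3623 ∷ 267374 ∷ 327782 ∷ 267293 ∷ 264361 ∷ 249241 ∷ 347770 ∷ 273704 ∷ 258728 ∷ 350794 ∷ 335682 ∷ 258656 ∷ 261257 ∷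
  276727 ∷ 276799 ∷ 291314 ∷ 336674 ∷ 351363 ∷ 277024 ∷ 350883 ∷ 277024 ∷ 276519 ∷ 335691 ∷ 260657 ∷ 3024 ∷ 335664 ∷
  336333 ∷ 352225 ∷ 261824 ∷ 264848 ∷ 290817 ∷ 262584 ∷ 336339 ∷ 321985 ∷ 262584 ∷ 336339 ∷ 336267 ∷ 336249 ∷
  348282 ∷ 276529 ∷ 260897 ∷ 291349 ∷ 261109 ∷ 276530 ∷ 276026 ∷ 359929 ∷ 321265 ∷ 275709 ∷ 3636 ∷ 260888 ∷ 261000 ∷
  258228 ∷ 276228 ∷ 261225 ∷ 172607 ∷ 338927 ∷ 338927 ∷ 260657 ∷ 504 ∷ 267285 ∷ 336407 ∷ 336839 ∷ 282339 ∷ 282340 ∷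
  267284 ∷ 267274 ∷ 333387 ∷ 276958 ∷ 332883 ∷ 320788 ∷ 274709 ∷ 336854 ∷ 320717 ∷ 279982 ∷ 276886 ∷ 261000 ∷
  321789 ∷ 320780 ∷ 321123 ∷ 264412 ∷ 272835 ∷ 272412 ∷ 260308 ∷ 261398 ∷ 359876 ∷ 260703 ∷ 275366 ∷ 276958 ∷
  261000 ∷ 261289 ∷ 260300 ∷ 276204 ∷ 261893 ∷ 261397 ∷ 276958 ∷ 264412 ∷ 276957 ∷ 264412 ∷ 176653 ∷ 249215 ∷
  240086 ∷ 260703 ∷ 264335 ∷ 263822 ∷ 321710 ∷ 321638 ∷ 79216 ∷ 357589 ∷ 300566 ∷ 300493 ∷ 260657 ∷ 213943 ∷ 244336 ∷
  201414 ∷ 221098 ∷ 251248 ∷ 188256 ∷ 257299 ∷ 197815 ∷ 184720 ∷ 219273 ∷ 262584 ∷ 188608 ∷ 260703 ∷ 197743 ∷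
  182481 ∷ 263121 ∷ 202641 ∷ 184567 ∷ 181473 ∷ 269136 ∷ 249126 ∷ 204349 ∷ 273822 ∷ 197725 ∷ 183102 ∷ 261000 ∷
  199734 ∷ 184630 ∷ 197214 ∷ 260584 ∷ 200597 ∷ 184982 ∷ 197070 ∷ 181455 ∷ 220141 ∷ 252343 ∷ 188829 ∷ 302400 ∷
  201332 ∷ 186300 ∷ 287280 ∷ 203445 ∷ 188174 ∷ 181773 ∷ 266653 ∷ 201205 ∷ 188101 ∷ 197660 ∷ 187589 ∷ 277417 ∷
  201322 ∷ 188218 ∷ 198227 ∷ 184547 ∷ 181451 ∷ []

γ₇-cancels : entries (canonise (map (lehmer 9) certificate) (entries (collect (dTerms γ₇-terms)))) ≡ []
γ₇-cancels = refl

γ₇-cocycle : IsZero (d γ₇)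
γ₇-cocycle = subst (λ x → IsZero (d x)) (sym γ₇-≡) (cocycle (map (lehmer 9) certificate) γ₇-terms γ₇-Simple γ₇-cancels)

-- The wheel functional

adjacent? : ∀ (es : Edges n) a b → Dec (Adjacent es a b)
adjacent? es a b = Any.any? (sameEdge? (a , b)) es

Triangulated : Edges n → Set
Triangulated es = ∀ a b → Adjacent es a b → InTriangle es (a , b)

triangulated? : (es : Edges n) → Dec (Triangulated es)
triangulated? es = Finₚ.all? λ a → Finₚ.all? λ b →
  adjacent? es a b →-dec Finₚ.any? λ w → adjacent? es a w ×-dec adjacent? es b w

-- An alternating function of the edge order

product : List ℤ → ℤ
product [] = 1ℤ
product (x ∷ xs) = x ℤ.* product xs

vandermonde : List ℤ → ℤ
vandermonde [] = 1ℤ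
vandermonde (x ∷ xs) = product (map (λ y → x ℤ.- y) xs) ℤ.* vandermonde xs

product-swap : ∀ xs {a b ys} → product (xs ++ a ∷ b ∷ ys) ≡ product (xs ++ b ∷ a ∷ ys)
product-swap [] {a} {b} {ys} = comm a b (product ys)
  where
  comm : ∀ a b c → a ℤ.* (b ℤ.* c) ≡ b ℤ.* (a ℤ.* c)
  comm = ℤ-solve-∀
product-swap (x ∷ xs) = cong (x ℤ.*_) (product-swap xs)

-- Exchanging two neighbours reverses the one factor `a - b` and permutes the others.
vandermonde-swap : ∀ xs {a b ys} → vandermonde (xs ++ b ∷ a ∷ ys) ≡ -1ℤ ℤ.* vandermonde (xs ++ a ∷ b ∷ ys)
vandermonde-swap [] {a} {b} {ys} =
  antisym a b (product (map (λ y → a ℤ.- y) ys)) (product (map (λ y → b ℤ.- y) ys)) (vandermonde ys)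
  where
  antisym : ∀ a b p q v → (b ℤ.- a) ℤ.* q ℤ.* (p ℤ.* v) ≡ -1ℤ ℤ.* ((a ℤ.- b) ℤ.* p ℤ.* (q ℤ.* v))
  antisym = ℤ-solve-∀
vandermonde-swap (x ∷ xs) {a} {b} {ys} = begin
  product (map (λ y → x ℤ.- y) (xs ++ b ∷ a ∷ ys)) ℤ.* vandermonde (xs ++ b ∷ a ∷ ys)
    ≡⟨ cong₂ ℤ._*_ factors (vandermonde-swap xs) ⟩
  p ℤ.* (-1ℤ ℤ.* vandermonde (xs ++ a ∷ b ∷ ys))
    ≡⟨ pull p (vandermonde (xs ++ a ∷ b ∷ ys)) ⟩
  -1ℤ ℤ.* (p ℤ.* vandermonde (xs ++ a ∷ b ∷ ys))  ∎
  where
  p = product (map (λ y → x ℤ.- y) (xs ++ a ∷ b ∷ ys))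
  pull : ∀ p v → p ℤ.* (-1ℤ ℤ.* v) ≡ -1ℤ ℤ.* (p ℤ.* v)
  pull = ℤ-solve-∀
  factors : product (map (λ y → x ℤ.- y) (xs ++ b ∷ a ∷ ys)) ≡ p
  factors = begin
    product (map (λ y → x ℤ.- y) (xs ++ b ∷ a ∷ ys))
      ≡⟨ cong product (map-++ (λ y → x ℤ.- y) xs (b ∷ a ∷ ys)) ⟩
    product (map (λ y → x ℤ.- y) xs ++ map (λ y → x ℤ.- y) (b ∷ a ∷ ys))   ≡⟨ product-swap (map (λ y → x ℤ.- y) xs) ⟩
    product (map (λ y → x ℤ.- y) xs ++ map (λ y → x ℤ.- y) (a ∷ b ∷ ys))
      ≡⟨ cong product (map-++ (λ y → x ℤ.- y) xs (a ∷ b ∷ ys)) ⟨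
    p                                             ∎

path : List (Fin n) → Edges n
path (r ∷ rs@(s ∷ _)) = (r , s) ∷ path rs
path _ = []

fan : Fin n → List (Fin n) → Edges n
fan h rs = map (h ,_) rs ++ path rs

-- Edges outside the list get position 0.  So a fan of the wheel, which has all its edges but the one that closes the rim,
-- gives the 14 edges distinct positions.
position : Edges n → Edge n → ℤ
position [] e = 0ℤ
position ts@(t ∷ ts′) e = if does (sameEdge? t e) then ℤ.+ length ts else position ts′ e

-- The Vandermonde product stands in for the sign of the edge order: it is alternating as well, and needs no permutations.
orientation : Edges n → Fin n → List (Fin n) → ℤ
orientation es h rs = vandermonde (map (position (fan h rs)) es)

adjacentToHead : Edges n → Fin n → List (Fin n) → Bool
adjacentToHead es u [] = true
adjacentToHead es u (r ∷ _) = does (adjacent? es u r)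

-- The rim grows by one neighbour of the hub `h` at a time. Walks that revisit a vertex are harmless
-- on 14 distinct edges: a fan over 7 vertices lists 13 edges, a repeated vertex repeats a spoke,
-- and then at least two edges get position 0, so that the Vandermonde product vanishes.
sumOverPaths : Edges n → Fin n → ℕ → List (Fin n) → ℤ
sumOverPaths es h zero rs = orientation es h rs
sumOverPaths es h (suc k) rs = sum λ u →
  if does (adjacent? es h u) ∧ adjacentToHead es u rs then sumOverPaths es h k (u ∷ rs) else 0ℤ

-- Summing over all fans makes φ invariant under relabelling; by the rotations and reflections of the wheel,
-- which are even on edges, its 14 summands on the wheel are equal.
opaque
  φ : LGraph → ℤ
  φ (n , es) = if does (triangulated? es) then sum (λ h → sumOverPaths es h 7 []) else 0ℤ

-- One argument for all three moves: each comes with a vertex permutation, the identity for swaps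
-- and flips, that preserves adjacency and multiplies every orientation by the same sign `σ`. The
-- sums over hubs and walks are then reindexed along `π`.
module Equivariance (π : Permutation′ n) {es es′ : Edges n}
  (adjacency : ∀ a b → Adjacent es a b ⇔ Adjacent es′ (π ⟨$⟩ʳ a) (π ⟨$⟩ʳ b))
  (σ : ℤ) (orients : ∀ h rs → orientation es′ (π ⟨$⟩ʳ h) (map (π ⟨$⟩ʳ_) rs) ≡ σ ℤ.* orientation es h rs) where

  private
    π⟨_⟩ : Fin n → Fin n
    π⟨_⟩ = π ⟨$⟩ʳ_

    module A a b = Equivalence (adjacency a b)

    adj-π : ∀ a b → does (adjacent? es′ π⟨ a ⟩ π⟨ b ⟩) ≡ does (adjacent? es a b)
    adj-π a b = sym (does-⇔ (adjacency a b) (adjacent? es a b) (adjacent? es′ π⟨ a ⟩ π⟨ b ⟩))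

    head-π : ∀ u rs → adjacentToHead es′ π⟨ u ⟩ (map π⟨_⟩ rs) ≡ adjacentToHead es u rs
    head-π u [] = refl
    head-π u (r ∷ _) = adj-π u r

    triangulated-π : Triangulated es ⇔ Triangulated es′
    triangulated-π = mk⇔ to from
      where
      to : Triangulated es → Triangulated es′
      to t a b ab with t (π ⟨$⟩ˡ a) (π ⟨$⟩ˡ b) (A.from _ _ (subst₂ (Adjacent es′) (sym (inverseʳ π)) (sym (inverseʳ π)) ab))
      ... | w , aw , bw = π⟨ w ⟩ , subst (λ c → Adjacent es′ c π⟨ w ⟩) (inverseʳ π) (A.to _ _ aw)
                                 , subst (λ c → Adjacent es′ c π⟨ w ⟩) (inverseʳ π) (A.to _ _ bw)
      from : Triangulated es′ → Triangulated es
      from t a b ab with t π⟨ a ⟩ π⟨ b ⟩ (A.to a b ab)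
      ... | w , aw , bw = π ⟨$⟩ˡ w , A.from _ _ (subst (Adjacent es′ π⟨ a ⟩) (sym (inverseʳ π)) aw)
                                   , A.from _ _ (subst (Adjacent es′ π⟨ b ⟩) (sym (inverseʳ π)) bw)

    if-* : ∀ c {x y} → x ≡ σ ℤ.* y → (if c then x else 0ℤ) ≡ σ ℤ.* (if c then y else 0ℤ)
    if-* true x≡ = x≡
    if-* false _ = sym (ℤₚ.*-zeroʳ σ)

    sum-π : ∀ {f g : Fin n → ℤ} → (∀ u → f π⟨ u ⟩ ≡ σ ℤ.* g u) → sum f ≡ σ ℤ.* sum g
    sum-π {f} {g} f≗ = trans (sum-permute f π) (trans (sum-cong-≗ f≗) (sym (*-distribˡ-sum σ g)))

    sumOverPaths-π : ∀ h k rs → sumOverPaths es′ π⟨ h ⟩ k (map π⟨_⟩ rs) ≡ σ ℤ.* sumOverPaths es h k rs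
    sumOverPaths-π h zero rs = orients h rs
    sumOverPaths-π h (suc k) rs = sum-π λ u → trans
      (cong₂ (λ p q → if p ∧ q then sumOverPaths es′ π⟨ h ⟩ k (map π⟨_⟩ (u ∷ rs)) else 0ℤ) (adj-π h u) (head-π u rs))
      (if-* (does (adjacent? es h u) ∧ adjacentToHead es u rs) (sumOverPaths-π h k (u ∷ rs)))

  opaque
    unfolding φ

    φ-π : φ (n , es′) ≡ σ ℤ.* φ (n , es)
    φ-π = trans
      (cong (λ t → if t then sum (λ h → sumOverPaths es′ h 7 []) else 0ℤ)
        (sym (does-⇔ triangulated-π (triangulated? es) (triangulated? es′))))
      (if-* (does (triangulated? es)) (sum-π λ h → sumOverPaths-π h 7 []))

module _ (π : Permutation′ n) where

  private
    π⟨_⟩ : Fin n → Fin n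
    π⟨_⟩ = π ⟨$⟩ʳ_

    πₑ : Edge n → Edge n
    πₑ (a , b) = π⟨ a ⟩ , π⟨ b ⟩

    SameEdge-πₑ : ∀ {e e′} → SameEdge e e′ ⇔ SameEdge (πₑ e) (πₑ e′)
    SameEdge-πₑ = mk⇔ (λ { (inj₁ (refl , refl)) → inj₁ (refl , refl) ; (inj₂ (refl , refl)) → inj₂ (refl , refl) })
                      (SameEdge-relabel⁻ π)

    relabelEdges-πₑ : ∀ es → relabelEdges π es ≡ map πₑ es
    relabelEdges-πₑ = map-cong λ _ → refl

    path-πₑ : ∀ rs → path (map π⟨_⟩ rs) ≡ map πₑ (path rs)
    path-πₑ [] = refl
    path-πₑ (r ∷ []) = refl
    path-πₑ (r ∷ rs@(s ∷ _)) = cong (_ ∷_) (path-πₑ rs)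

    fan-πₑ : ∀ h rs → fan π⟨ h ⟩ (map π⟨_⟩ rs) ≡ map πₑ (fan h rs)
    fan-πₑ h rs = begin
      map (π⟨ h ⟩ ,_) (map π⟨_⟩ rs) ++ path (map π⟨_⟩ rs)
        ≡⟨ cong₂ _++_ (trans (sym (map-∘ rs)) (map-∘ rs)) (path-πₑ rs) ⟩
      map πₑ (map (h ,_) rs) ++ map πₑ (path rs)           ≡⟨ map-++ πₑ (map (h ,_) rs) (path rs) ⟨
      map πₑ (fan h rs)                                    ∎

    position-πₑ : ∀ ts e → position (map πₑ ts) (πₑ e) ≡ position ts e
    position-πₑ [] e = refl
    position-πₑ (t ∷ ts) e
      rewrite does-⇔ (SameEdge-πₑ {t} {e}) (sameEdge? t e) (sameEdge? (πₑ t) (πₑ e))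
            | length-map πₑ ts | position-πₑ ts e = refl

  φ-relabel : ∀ es → φ (n , relabelEdges π es) ≡ φ (n , es)
  φ-relabel es = trans (Equivariance.φ-π π adjacency 1ℤ orients) (ℤₚ.*-identityˡ _)
    where
    adjacency : ∀ a b → Adjacent es a b ⇔ Adjacent (relabelEdges π es) π⟨ a ⟩ π⟨ b ⟩
    adjacency a b = mk⇔ (Anyₚ.map⁺ ∘ Any.map (Equivalence.to SameEdge-πₑ)) (Any.map (Equivalence.from SameEdge-πₑ) ∘ Anyₚ.map⁻)
    orients : ∀ h rs → orientation (relabelEdges π es) π⟨ h ⟩ (map π⟨_⟩ rs) ≡ 1ℤ ℤ.* orientation es h rs
    orients h rs = trans (cong vandermonde (begin
      map (position (fan π⟨ h ⟩ (map π⟨_⟩ rs))) (relabelEdges π es)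
        ≡⟨ cong₂ (λ ts fs → map (position ts) fs) (fan-πₑ h rs) (relabelEdges-πₑ es) ⟩
      map (position (map πₑ (fan h rs))) (map πₑ es)                 ≡⟨ map-∘ es ⟨
      map (position (map πₑ (fan h rs)) ∘ πₑ) es                     ≡⟨ map-cong (position-πₑ (fan h rs)) es ⟩
      map (position (fan h rs)) es                                   ∎)) (sym (ℤₚ.*-identityˡ _))

φ-swap : ∀ (xs : Edges n) a b ys → φ (n , xs ++ b ∷ a ∷ ys) ≡ ℤ.- φ (n , xs ++ a ∷ b ∷ ys)
φ-swap xs a b ys = trans (Equivariance.φ-π id
  (λ _ _ → mk⇔ (Any-resp-↭ (++⁺ˡ xs (swap a b ↭-refl))) (Any-resp-↭ (++⁺ˡ xs (swap b a ↭-refl)))) -1ℤ orients) (ℤₚ.-1*i≡-i _)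
  where
  orients : ∀ h rs → orientation (xs ++ b ∷ a ∷ ys) h (map (λ i → i) rs) ≡ -1ℤ ℤ.* orientation (xs ++ a ∷ b ∷ ys) h rs
  orients h rs rewrite map-id rs
    | map-++ (position (fan h rs)) xs (b ∷ a ∷ ys) | map-++ (position (fan h rs)) xs (a ∷ b ∷ ys) =
    vandermonde-swap (map (position (fan h rs)) xs)

φ-flip : ∀ (xs : Edges n) a b ys → φ (n , xs ++ (b , a) ∷ ys) ≡ φ (n , xs ++ (a , b) ∷ ys)
φ-flip xs a b ys = trans (Equivariance.φ-π id (λ _ _ → mk⇔ (Adjacent-flip xs) (Adjacent-flip xs)) 1ℤ orients) (ℤₚ.*-identityˡ _)
  where
  Adjacent-flip : ∀ xs {a b c d} → Adjacent (xs ++ (a , b) ∷ ys) c d → Adjacent (xs ++ (b , a) ∷ ys) c d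
  Adjacent-flip [] (here p) = here (SameEdge-flipʳ p)
  Adjacent-flip [] (there p) = there p
  Adjacent-flip (x ∷ xs) (here p) = here p
  Adjacent-flip (x ∷ xs) (there p) = there (Adjacent-flip xs p)
  position-flip : ∀ ts → position ts (b , a) ≡ position ts (a , b)
  position-flip [] = refl
  position-flip (t ∷ ts)
    rewrite does-⇔ (mk⇔ SameEdge-flipʳ SameEdge-flipʳ) (sameEdge? t (a , b)) (sameEdge? t (b , a))
          | position-flip ts = refl
  orients : ∀ h rs → orientation (xs ++ (b , a) ∷ ys) h (map (λ i → i) rs) ≡ 1ℤ ℤ.* orientation (xs ++ (a , b) ∷ ys) h rs
  orients h rs rewrite map-id rs
    | map-++ (position (fan h rs)) xs ((b , a) ∷ ys) | map-++ (position (fan h rs)) xs ((a , b) ∷ ys)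
    | position-flip (fan h rs) = sym (ℤₚ.*-identityˡ _)

-- Vanishing of the functional on coboundaries and relations

opaque
  unfolding φ

  φ-¬InTriangle : ∀ (es : Edges n) {e} → e ∈ es → ¬ InTriangle es e → φ (n , es) ≡ 0ℤ
  φ-¬InTriangle es {a , b} e∈ ¬tri = cong (λ t → if t then sum (λ h → sumOverPaths es h 7 []) else 0ℤ)
    (dec-false (triangulated? es) (λ t → ¬tri (t a b (lose e∈ (inj₁ (refl , refl))))))

φ-split : ∀ {G K} → Simple G → K ∈ ins dot-dot G → φ K ≡ 0ℤ
φ-split {suc m , es} s K∈ with ∈-ins-split {m} {es} K∈
... | v , r , r∈ , refl = φ-¬InTriangle _ (here refl) (Split.split-¬InTriangle s v r∈)

φ-pendant : ∀ {G K} → Simple G → K ∈ ins G dot-dot → φ K ≡ 0ℤ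
φ-pendant {n , es} s K∈ with ∈-ins-pendant {n} {es} K∈
... | i , e , e~ , refl = φ-¬InTriangle _ (∈-++⁺ʳ _ (here refl)) (Pendant.pendant-¬InTriangle s i e~)

-- The embedding `ι` divides by 16, which does not affect whether a value vanishes, and its laws for
-- zero and negation are already available.
φℚ : LGraph → ℚ
φℚ = ι ∘ φ

φℚ-zero : ∀ {G} → φ G ≡ 0ℤ → φℚ G ≡ 0ℚ
φℚ-zero φG≡0 = trans (cong ι φG≡0) ι-0

eval-φ-d : ∀ {x} → All (Simple ∘ proj₂) x → eval φℚ (d x) ≡ 0ℚ
eval-φ-d ss = eval-vanish φℚ (Allₚ.++⁺ (Allₚ.concat⁺ (Allₚ.map⁺ (All.map (λ s →
  Allₚ.++⁺ (Allₚ.map⁺ (All.tabulate (φℚ-zero ∘ φ-split s))) (Allₚ.map⁺ (All.tabulate (φℚ-zero ∘ φ-pendant s)))) ss))) [])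

eval-even : ∀ {S T} → φ T ≡ φ S → eval φℚ ((1ℚ , S) ∷ (- 1ℚ , T) ∷ []) ≡ 0ℚ
eval-even {S} {T} φT≡ = trans
  (cong (λ a → 1ℚ * φℚ S + (- 1ℚ * ι a + 0ℚ)) φT≡)
  (solve 1 (λ a → con 1ℚ :* a :+ (con (- 1ℚ) :* a :+ con 0ℚ) := con 0ℚ) refl (φℚ S))
  where open +-*-Solver

eval-odd : ∀ {S T} → φ T ≡ ℤ.- φ S → eval φℚ ((1ℚ , S) ∷ (1ℚ , T) ∷ []) ≡ 0ℚ
eval-odd {S} {T} φT≡ = trans
  (cong (λ a → 1ℚ * φℚ S + (1ℚ * a + 0ℚ)) (trans (cong ι φT≡) (ι-neg (φ S))))
  (solve 1 (λ a → con 1ℚ :* a :+ (con 1ℚ :* (:- a) :+ con 0ℚ) := con 0ℚ) refl (φℚ S))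
  where open +-*-Solver

eval-φ-relation : ∀ m → eval φℚ (relation m) ≡ 0ℚ
eval-φ-relation (relabel n es π) = eval-even (φ-relabel π es)
eval-φ-relation (swapE n xs a b ys) = eval-odd (φ-swap xs a b ys)
eval-φ-relation (flipE n xs a b ys) = eval-even (φ-flip xs a b ys)

eval-φ-total : ∀ rs → eval φℚ (total rs) ≡ 0ℚ
eval-φ-total [] = refl
eval-φ-total ((q , m , _) ∷ rs) = begin
  eval φℚ (scale q (relation m) ++ total rs)                   ≡⟨ eval-++ φℚ (scale q (relation m)) (total rs) ⟩
  eval φℚ (scale q (relation m)) + eval φℚ (total rs)
    ≡⟨ cong₂ _+_ (eval-scale φℚ q (relation m)) (eval-φ-total rs) ⟩
  q * eval φℚ (relation m) + 0ℚ                                ≡⟨ cong (λ a → q * a + 0ℚ) (eval-φ-relation m) ⟩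
  q * 0ℚ + 0ℚ                                                  ≡⟨ cong (_+ 0ℚ) (*-zeroʳ q) ⟩
  0ℚ                                                           ∎

opaque
  unfolding φ ι

  eval-φ-γ₇ : eval φℚ γ₇ ≢ 0ℚ
  -- On the wheel every fan places the 14 edges at the distinct positions 13, ..., 0, so the equal
  -- summands are nonzero and cannot cancel.
  eval-φ-γ₇ = from-no (eval φℚ γ₇ ≟ 0ℚ)

φ-detects : ∀ {x y} → All (Simple ∘ proj₂) x → IsZero (d x − y) → eval φℚ y ≡ 0ℚ
φ-detects {x} {y} ss vanishes with IsZero⇒total {d x − y} vanishes
... | rs , eq = begin
  eval φℚ y
    ≡⟨ solve 1 (λ a → a := con 0ℚ :+ :- (con 0ℚ :+ con (- 1ℚ) :* a)) refl (eval φℚ y) ⟩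
  0ℚ + - (0ℚ + - 1ℚ * eval φℚ y)                         ≡⟨ cong (λ a → 0ℚ + - a) (begin
    0ℚ + - 1ℚ * eval φℚ y                                  ≡⟨ cong₂ _+_ (eval-φ-d {x} ss) (eval-scale φℚ (- 1ℚ) y) ⟨
    eval φℚ (d x) + eval φℚ (scale (- 1ℚ) y)               ≡⟨ eval-++ φℚ (d x) _ ⟨
    eval φℚ (d x − y)                                      ≡⟨ eval-cong φℚ (d x − y) (total rs) eq ⟩
    eval φℚ (total rs)                                     ≡⟨ eval-φ-total rs ⟩
    0ℚ                                                     ∎) ⟩
  0ℚ                                                     ∎
  where open +-*-Solver

γ₇-notCoboundary : ¬ (Σ Combo λ δ → All (λ qG → Simple (proj₂ qG) × Connected (proj₂ qG)) δ × IsZero (d δ − γ₇))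
γ₇-notCoboundary (x , simpleConnected , vanishes) = eval-φ-γ₇ (φ-detects {x} {γ₇} (All.map proj₁ simpleConnected) vanishes)

theorem3 : IsZero (d γ₇)
    × ¬ (Σ Combo λ δ → All (λ qG → Simple (proj₂ qG) × Connected (proj₂ qG)) δ × IsZero (d δ − γ₇))
theorem3 = γ₇-cocycle , γ₇-notCoboundary
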